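{- For every integer $k\geqslant 2$, there are positive constants $c$, $C$ and $n_0\in\mathbb{N}$ such that for every non-decreasing function $f:\mathbb{N}\to\mathbb{N}$ with $n\leqslant f(n)\leqslant R(K_n)$ for all $n$, there is a sequence of connected graphs $(G_n)_{n\in\mathbb{N}}$ with $|V(G_n)|=n$ such that $c f(n)\leqslant R(G_n)\leqslant C f(n)$ for all $n\in\mathbb{N}$. Moreover, $\chi(G_n)\geqslant k$ for every $n\geqslant n_0$.
   Context: For a graph $G$, the Ramsey number $R(G)$ is the smallest integer $N$ such that every two-colouring of the edges of the complete graph $K_N$ contains a monochromatic copy of $G$. $\chi(G)$ denotes the chromatic number of $G$. -}

module Defs where

open import Data.Bool using (Bool)
open import Data.Fin using (Fin)
open import Data.Fin.Properties using (_≟_)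
open import Data.Integer using (+_)
open import Data.Nat using (ℕ; NonZero; _≤_)
open import Data.Product using (∃-syntax; Σ-syntax; _×_)
open import Data.Rational using (ℚ)
open import Data.Rational.Literals using (fromℤ)
open import Function using (Injective)
open import Level using (0ℓ)
open import Relation.Binary.Core using (Rel)
open import Relation.Binary.Construct.Closure.ReflexiveTransitive using (Star)
open import Relation.Binary.Definitions using (Symmetric; Irreflexive; Decidable)
open import Relation.Binary.PropositionalEquality using (_≡_; _≢_; ≢-sym)
open import Relation.Nullary using (¬?)

fromℕ : ℕ → ℚ
fromℕ n = fromℤ (+ n)

IsLeast : (ℕ → Set) → ℕ → Set
IsLeast P n = P n × (∀ m → P m → n ≤ m)

record Graph (n : ℕ) : Set₁ where
  field
    Adj    : Rel (Fin n) 0ℓ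
    sym    : Symmetric Adj
    irrefl : Irreflexive _≡_ Adj
    adj?   : Decidable Adj

open Graph public using (Adj)

K : ∀ n → Graph n
K n = record
  { Adj    = _≢_
  ; sym    = ≢-sym
  ; irrefl = λ i≡j i≢j → i≢j i≡j
  ; adj?   = λ i j → ¬? (i ≟ j)
  }

Connected : ∀ {n} → Graph n → Set
Connected {n} G = NonZero n × (∀ u v → Star (Adj G) u v)

-- A two-colouring of the edges of K N. The values colour i i on the diagonal
-- belong to no edge and are never consulted: in MonochromaticCopy below, the
-- ends of an edge are distinct and φ is injective.
record EdgeColouring (N : ℕ) : Set where
  field
    colour     : Fin N → Fin N → Bool
    colour-sym : ∀ i j → colour i j ≡ colour j i

open EdgeColouring public using (colour)

MonochromaticCopy : ∀ {n N} → Graph n → EdgeColouring N → Set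
MonochromaticCopy {n} {N} G κ =
  ∃[ b ] Σ[ φ ∈ (Fin n → Fin N) ] Injective _≡_ _≡_ φ
    × (∀ u v → Adj G u v → colour κ (φ u) (φ v) ≡ b)

-- IsRamseyNumber G r says R(G) = r. It is a relation so that no proof of
-- Ramsey's theorem is built into the definition.
IsRamseyNumber : ∀ {n} → Graph n → ℕ → Set
IsRamseyNumber G = IsLeast λ N → (κ : EdgeColouring N) → MonochromaticCopy G κ

Colourable : ∀ {n} → Graph n → ℕ → Set
Colourable {n} G m =
  Σ[ f ∈ (Fin n → Fin m) ] (∀ u v → Adj G u v → f u ≢ f v)

IsChromaticNumber : ∀ {n} → Graph n → ℕ → Set
IsChromaticNumber G = IsLeast (Colourable G)

{-# OPTIONS --safe #-}
-- Let R(m, n) be the Ramsey number of K_m with n − m pendant vertices at one of its vertices. For fixed n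
-- it grows from O(n) at m = k to at least R(K_n) at m = n; if it grows by a bounded factor at each step,
-- then the least m with R(m, n) ≥ f(n) gives G_n. Since (m − 1)(n − 1) < R(m, n) ≤ R(K_m) + 2mn, this
-- reduces to R(K_{m+1}) = O(R(K_m)).
--
-- Put M = R(K_m) and take a colouring without monochromatic K_{m+1}. If v has M common neighbours
-- with w, of colour b at v and of the other colour at w, these contain a monochromatic K_m, which v
-- or w extends. Hence in the b-neighbourhood of v every vertex has fewer than M neighbours of the other
-- colour. For b the majority colour at v this set is nearly monochromatic, and as M is exponential in
-- m, the argument of Erdős and Szemerédi finds a K_{m+1} in it.
module Submission where

open import Defs
open import Data.Bool using (Bool; true; false; not; if_then_else_; _∧_)
import Data.Bool.Properties as Bool
open import Data.Empty using (⊥-elim)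
open import Data.Fin
  using (Fin; zero; suc; toℕ; fromℕ<; inject≤; _↑ˡ_; _↑ʳ_; finToFun; funToFin; combine; quotient;
         remainder)
import Data.Fin.Properties as Fin
open import Data.Integer as ℤ using (+≤+)
import Data.Integer.Properties as ℤ
open import Data.List
  using (List; []; _∷_; _++_; length; filter; map; allFin; take; lookup; tabulate)
import Data.List.Membership.DecPropositional as DecMembership
open import Data.List.Membership.Propositional using (_∈_; _∉_)
open import Data.List.Membership.Propositional.Properties
  using (∈-filter⁻; ∈-filter⁺; ∈-allFin; ∈-lookup; ∈-map⁻; ∈-map⁺; ∈-++⁻; ∈-++⁺ˡ; ∈-++⁺ʳ;
         ∈-tabulate⁻)
open import Data.List.Properties
  using (filter-none; filter-accept; length-++; length-take; length-map; length-tabulate)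
open import Data.List.Relation.Binary.Subset.Propositional using (_⊆_)
open import Data.List.Relation.Unary.All as All using (All; []; _∷_)
open import Data.List.Relation.Unary.All.Properties using (all-filter)
import Data.List.Relation.Unary.All.Properties as All
open import Data.List.Relation.Unary.AllPairs as AllPairs using (AllPairs; []; _∷_)
import Data.List.Relation.Unary.AllPairs.Properties as AllPairs
open import Data.List.Relation.Unary.Any using (here; there)
open import Data.List.Relation.Unary.Unique.Propositional using (Unique)
open import Data.List.Relation.Unary.Unique.Propositional.Properties
  using (filter⁺; allFin⁺; tabulate⁺; ++⁺; Unique[x∷xs]⇒x∉xs)
open import Data.Maybe using (Maybe; just; nothing)
open import Data.Nat
open import Data.Nat.DivMod using (m≡m%n+[m/n]*n; m%n<n; m/n*n≤m)
open import Data.Nat.ListAction using (sum)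
open import Data.Nat.Properties
open import Data.Nat.Solver using (module +-*-Solver)
open import Data.Product using (∃-syntax; Σ-syntax; _×_; _,_; proj₁; proj₂)
open import Data.Rational as ℚ using (ℚ; 0ℚ; 1ℚ; *≤*)
import Data.Rational.Properties as ℚ
open import Data.Rational.Unnormalised as ℚᵘ using (*≡*)
import Data.Rational.Unnormalised.Properties as ℚᵘ
open import Data.Sum using (_⊎_; inj₁; inj₂; [_,_]′)
open import Data.Unit using (⊤; tt)
open import Data.Vec as Vec using (Vec; []; _∷_)
import Data.Vec.Functional as Functional
import Data.Vec.Properties as Vec
open import Function using (_∘_; id; Injective; case_of_)
open import Level using (0ℓ)
open import Relation.Binary.Construct.Closure.ReflexiveTransitive using (Star; ε; _◅_; _◅◅_)
open import Relation.Binary.Definitions using (DecidableEquality)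
open import Relation.Binary.PropositionalEquality
open import Relation.Nullary using (¬_; Dec; yes; no; ¬?; contradiction)
open import Relation.Nullary.Decidable
  using (_×-dec_; _→-dec_; _⊎-dec_; map′; does; decidable-stable; toSum)
open import Relation.Unary using (Pred; Decidable)
open import Algebra.Properties.CommutativeSemigroup +-commutativeSemigroup
  using (x∙yz≈y∙xz; interchange)
import Algebra.Properties.CommutativeSemigroup *-commutativeSemigroup as *-Semigroup

open ≤-Reasoning

-- Quantitatively: let `A` be the nearly monochromatic set, let `T` be a clique of at most m
-- vertices in it, and let s = ⌊m / 45⌋. Counting missing edges between `T` and `A` leaves at least
-- M vertices of `A` that miss at most s vertices of `T`. The possible missed sets number at most
-- C(m+s, s), and C(m+s, s) is also the Erdős-Szekeres bound for a clique of m + 1 vertices in one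
-- colour or s + 1 in the other. So the argument needs C(m+s, s)² < M. Since the counting lower
-- bound gives M only about 2^(m/2), s has to be a small fraction of m. The fraction 1/45 costs a
-- factor 2 · 46 = 92 between consecutive m; this is raised to 252 = C(10, 5), which also covers the
-- m ≤ 5 where the lower bound is too weak. Ramsey numbers must be exhibited, not merely bounded, so
-- the Ramsey property is decided by finite search and its least witness taken.

-- Counting in lists: covers, Markov's inequality, double counting.

module Counting (A : Set) where

  count : {P : Pred A 0ℓ} → Decidable P → List A → ℕ
  count P? xs = length (filter P? xs)

  count-∷ : {P : Pred A 0ℓ} (P? : Decidable P) → ∀ x xs → count P? xs ≤ count P? (x ∷ xs)
  count-∷ P? x xs with P? x
  ... | yes _ = n≤1+n _
  ... | no  _ = ≤-refl

  count-cover : {P Q : Pred A 0ℓ} (P? : Decidable P) (Q? : Decidable Q) →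
                ∀ {xs} → All (λ x → P x ⊎ Q x) xs → length xs ≤ count P? xs + count Q? xs
  count-cover P? Q? [] = z≤n
  count-cover P? Q? {x ∷ xs} (pq ∷ pqs) with ih ← count-cover P? Q? pqs | P? x | Q? x
  ... | yes _ | yes _ = s≤s (≤-trans ih (+-monoʳ-≤ (count P? xs) (n≤1+n _)))
  ... | yes _ | no  _ = s≤s ih
  ... | no  _ | yes _ = ≤-trans (s≤s ih) (≤-reflexive (sym (+-suc _ _)))
  ... | no ¬p | no ¬q = ⊥-elim ([ ¬p , ¬q ]′ pq)

  count-cover¬ : {P : Pred A 0ℓ} (P? : Decidable P) → ∀ xs →
                 length xs ≤ count P? xs + count (¬? ∘ P?) xs
  count-cover¬ P? xs = count-cover P? (¬? ∘ P?) {xs} (All.tabulate λ {x} _ → toSum (P? x))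

  markov : {P : Pred A 0ℓ} (P? : Decidable P) (g : A → ℕ) → ∀ q → (∀ {x} → P x → q ≤ g x) →
           ∀ xs → q * count P? xs ≤ sum (map g xs)
  markov P? g q q≤g [] = ≤-reflexive (*-zeroʳ q)
  markov P? g q q≤g (x ∷ xs) with ih ← markov P? g q q≤g xs | P? x
  ... | yes px = ≤-trans (≤-reflexive (*-suc q _)) (+-mono-≤ (q≤g px) ih)
  ... | no  _  = ≤-trans ih (m≤n+m _ (g x))

  module _ {R : A → Pred A 0ℓ} (R? : ∀ t → Decidable (R t)) where

    degree : List A → A → ℕ
    degree ts x = length (filter (λ t → R? t x) ts)

    degree-mono : ∀ t ts x → degree ts x ≤ degree (t ∷ ts) x
    degree-mono t ts x with R? t x
    ... | yes _ = n≤1+n _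
    ... | no  _ = ≤-refl

    degree-suc : ∀ t ts {x} → R t x → degree (t ∷ ts) x ≡ suc (degree ts x)
    degree-suc t ts {x} r = cong length (filter-accept (λ t → R? t x) {t} {ts} r)

    sum-degree : ∀ t ts xs → sum (map (degree (t ∷ ts)) xs) ≡ count (R? t) xs + sum (map (degree ts) xs)
    sum-degree t ts [] = refl
    sum-degree t ts (x ∷ xs) with ih ← sum-degree t ts xs | R? t x
    ... | no  _ = trans (cong (degree ts x +_) ih) (x∙yz≈y∙xz (degree ts x) (count (R? t) xs) _)
    ... | yes _ = cong suc (trans (cong (degree ts x +_) ih) (x∙yz≈y∙xz (degree ts x) (count (R? t) xs) _))

    -- Double counting of the pairs `(t, x)` with `R t x`: summed over `x` on the left, over `t` on
    -- the right.
    sum-degree-≤ : ∀ {d} ts xs → All (λ t → count (R? t) xs ≤ d) ts →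
                   sum (map (degree ts) xs) ≤ length ts * d
    sum-degree-≤ [] [] [] = z≤n
    sum-degree-≤ {d} [] (x ∷ xs) [] = sum-degree-≤ {d} [] xs []
    sum-degree-≤ {d} (t ∷ ts) xs (t≤d ∷ ts≤d) = begin
      sum (map (degree (t ∷ ts)) xs)               ≡⟨ sum-degree t ts xs ⟩
      count (R? t) xs + sum (map (degree ts) xs)   ≤⟨ +-mono-≤ t≤d (sum-degree-≤ ts xs ts≤d) ⟩
      d + length ts * d                            ∎

  module _ (_≟_ : DecidableEquality A) where

    open DecMembership _≟_ using (_∈?_)

    count-≡-≤1 : ∀ t {xs} → Unique xs → count (t ≟_) xs ≤ 1
    count-≡-≤1 t [] = z≤n
    count-≡-≤1 t {x ∷ xs} (x∉xs ∷ u) with t ≟ x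
    ... | no  _    = count-≡-≤1 t u
    ... | yes refl rewrite filter-none (t ≟_) x∉xs = ≤-refl

    unique-⊆⇒≤ : ∀ {xs} → Unique xs → ∀ ts → xs ⊆ ts → length xs ≤ length ts
    unique-⊆⇒≤ {[]}    u [] ⊆ts = z≤n
    unique-⊆⇒≤ {x ∷ _} u [] ⊆ts with () ← ⊆ts (here refl)
    unique-⊆⇒≤ {xs} u (t ∷ ts) ⊆ts = begin
      length xs                                ≤⟨ count-cover¬ (t ≟_) xs ⟩
      count (t ≟_) xs + count (¬? ∘ (t ≟_)) xs ≤⟨ +-mono-≤ (count-≡-≤1 t u) (unique-⊆⇒≤ (filter⁺ (¬? ∘ (t ≟_)) u) ts rest⊆) ⟩
      suc (length ts)                          ∎
      where
      rest⊆ : filter (¬? ∘ (t ≟_)) xs ⊆ ts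
      rest⊆ y∈ with y∈xs , t≢y ← ∈-filter⁻ (¬? ∘ (t ≟_)) {xs = xs} y∈ with ⊆ts y∈xs
      ... | here y≡t  = contradiction (sym y≡t) t≢y
      ... | there y∈ts = y∈ts

    length-without : ∀ {xs} → Unique xs → ∀ ts → length xs ≤ length ts + count (¬? ∘ (_∈? ts)) xs
    length-without {xs} u ts = ≤-trans (count-cover¬ (_∈? ts) xs)
      (+-monoˡ-≤ _ (unique-⊆⇒≤ (filter⁺ (_∈? ts) u) ts (proj₂ ∘ ∈-filter⁻ (_∈? ts) {xs = xs})))

AllPairs-lookup : ∀ {A : Set} {R : A → A → Set} → (∀ {x y} → R x y → R y x) →
                  ∀ {xs} → AllPairs R xs → ∀ i j → i ≢ j → R (lookup xs i) (lookup xs j)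
AllPairs-lookup R-sym (_ ∷ _)  zero    zero    i≢j = contradiction refl i≢j
AllPairs-lookup R-sym (r ∷ _)  zero    (suc j) _   = All.lookup r (∈-lookup j)
AllPairs-lookup R-sym (r ∷ _)  (suc i) zero    _   = R-sym (All.lookup r (∈-lookup i))
AllPairs-lookup R-sym (_ ∷ rs) (suc i) (suc j) i≢j = AllPairs-lookup R-sym rs i j (i≢j ∘ cong suc)

Unique-lookup-injective : ∀ {n} {xs : List (Fin n)} → Unique xs → Injective _≡_ _≡_ (lookup xs)
Unique-lookup-injective u {i} {j} eq with i Fin.≟ j
... | yes i≡j = i≡j
... | no  i≢j = contradiction eq (AllPairs-lookup ≢-sym u i j i≢j)

-- Cliques in a two-coloured complete graph and the Erdős-Szekeres bound.

-- binom p q is the binomial coefficient (p+q choose p).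
binom : ℕ → ℕ → ℕ
binom zero    q       = 1
binom (suc p) zero    = 1
binom (suc p) (suc q) = binom p (suc q) + binom (suc p) q

binom-monoˡ : ∀ p q → binom p q ≤ binom (suc p) q
binom-monoˡ zero    zero    = ≤-refl
binom-monoˡ (suc p) zero    = ≤-refl
binom-monoˡ zero    (suc q) = m≤m+n 1 _
binom-monoˡ (suc p) (suc q) = m≤m+n (binom (suc p) (suc q)) _

binom-≥1 : ∀ p q → 1 ≤ binom p q
binom-≥1 zero    q = ≤-refl
binom-≥1 (suc p) zero = ≤-refl
binom-≥1 (suc p) (suc q) = ≤-trans (binom-≥1 p (suc q)) (m≤m+n _ _)

Ramsey : ∀ {n} → Graph n → ℕ → Set
Ramsey G N = (κ : EdgeColouring N) → MonochromaticCopy G κ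

-- If both alternatives failed, `a + b` would be at least `x + y + 2`. The `suc` is room for the
-- vertex whose two neighbourhoods have sizes `x` and `y`.
split-+ : ∀ {a b x y} → a + b ≤ suc (x + y) → a ≤ x ⊎ b ≤ y
split-+ {a} {b} {x} {y} a+b≤ with a ≤? x | b ≤? y
... | yes a≤x | _ = inj₁ a≤x
... | no _ | yes b≤y = inj₂ b≤y
... | no a≰x | no b≰y = contradiction
  (≤-trans (≤-reflexive (sym (cong suc (+-suc x y)))) (≤-trans (+-mono-≤ (≰⇒> a≰x) (≰⇒> b≰y)) a+b≤)) 1+n≰n

module Cliques {N : ℕ} (κ : EdgeColouring N) where

  open Counting (Fin N) public
  open DecMembership {A = Fin N} Fin._≟_ public using (_∈?_)

  Edge : Bool → Fin N → Fin N → Set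
  Edge b u v = u ≢ v × colour κ u v ≡ b

  edge? : ∀ b u → Decidable (Edge b u)
  edge? b u v = ¬? (u Fin.≟ v) ×-dec (colour κ u v Bool.≟ b)

  edge-sym : ∀ {b u v} → Edge b u v → Edge b v u
  edge-sym (u≢v , eq) = u≢v ∘ sym , trans (EdgeColouring.colour-sym κ _ _) eq

  edge-total : ∀ b {u v} → u ≢ v → Edge b u v ⊎ Edge (not b) u v
  edge-total b {u} {v} u≢v with colour κ u v Bool.≟ b
  ... | yes eq = inj₁ (u≢v , eq)
  ... | no neq = inj₂ (u≢v , Bool.¬-not neq)

  nonEdge? : ∀ b u → Decidable (¬_ ∘ Edge b u)
  nonEdge? b u = ¬? ∘ edge? b u

  HasClique : Bool → ℕ → List (Fin N) → Set
  HasClique b m U = ∃[ xs ] length xs ≡ m × AllPairs (Edge b) xs × xs ⊆ U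

  clique-⊆ : ∀ {b m U W} → U ⊆ W → HasClique b m U → HasClique b m W
  clique-⊆ U⊆W (xs , len , pairs , xs⊆U) = xs , len , pairs , U⊆W ∘ xs⊆U

  clique-∷ : ∀ {b m v U W} → v ∈ U → W ⊆ U → All (Edge b v) W → HasClique b m W → HasClique b (suc m) U
  clique-∷ {v = v} {U} v∈U W⊆U v~W (xs , len , pairs , xs⊆W) =
    v ∷ xs , cong suc len , All.tabulate (All.lookup v~W ∘ xs⊆W) ∷ pairs ,
    λ { (here refl) → v∈U ; (there x∈) → W⊆U (xs⊆W x∈) }

  clique-≤ : ∀ {b m n U} → m ≤ n → HasClique b n U → HasClique b m U
  clique-≤ {m = m} m≤n (xs , refl , pairs , xs⊆U) =
    take m xs , trans (length-take m xs) (m≤n⇒m⊓n≡m m≤n) , AllPairs.take⁺ m pairs , xs⊆U ∘ take-⊆ m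
    where
    take-⊆ : ∀ m {ys : List (Fin N)} → take m ys ⊆ ys
    take-⊆ (suc m) {y ∷ ys} (here eq) = here eq
    take-⊆ (suc m) {y ∷ ys} (there z∈) = there (take-⊆ m z∈)

  nbrs : Bool → Fin N → List (Fin N) → List (Fin N)
  nbrs b v U = filter (edge? b v) U

  nbrs-⊆ : ∀ b v U → nbrs b v U ⊆ U
  nbrs-⊆ b v U = proj₁ ∘ ∈-filter⁻ (edge? b v) {xs = U}

  nbrs-unique : ∀ b v {U} → Unique U → Unique (nbrs b v U)
  nbrs-unique b v = filter⁺ (edge? b v)

  nbrs-cover : ∀ b {v U} → All (v ≢_) U → length U ≤ length (nbrs b v U) + length (nbrs (not b) v U)
  nbrs-cover b {v} v∉U = count-cover (edge? b v) (edge? (not b) v) (All.map (edge-total b) v∉U)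

  -- The recurrence of `binom` is the classical one: the first vertex has `binom p (suc q)`
  -- neighbours of colour `b` or `binom (suc p) q` of the other, and extends a clique found there.
  -- The indices are one below the clique sizes.
  erdős-szekeres : ∀ b p q {U} → Unique U → binom p q ≤ length U →
                   HasClique b (suc p) U ⊎ HasClique (not b) (suc q) U
  erdős-szekeres b p q {[]} _ 1≤ = contradiction (≤-trans (binom-≥1 p q) 1≤) 1+n≰n
  erdős-szekeres b zero    q       {v ∷ U} u _ =
    inj₁ (clique-∷ {W = []} (here refl) (λ ()) [] ([] , refl , [] , λ ()))
  erdős-szekeres b (suc p) zero    {v ∷ U} u _ =
    inj₂ (clique-∷ {W = []} (here refl) (λ ()) [] ([] , refl , [] , λ ()))
  erdős-szekeres b (suc p) (suc q) {v ∷ U} (v∉U ∷ u) large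
    with split-+ {binom p (suc q)} {binom (suc p) q} (≤-trans large (s≤s (nbrs-cover b v∉U)))
  ... | inj₁ large₁ with erdős-szekeres b p (suc q) (nbrs-unique b v u) large₁
  ...   | inj₁ cl = inj₁ (clique-∷ (here refl) (there ∘ nbrs-⊆ b v U) (all-filter (edge? b v) U) cl)
  ...   | inj₂ cl = inj₂ (clique-⊆ (there ∘ nbrs-⊆ b v U) cl)
  erdős-szekeres b (suc p) (suc q) {v ∷ U} (v∉U ∷ u) large
    | inj₂ large₂ with erdős-szekeres b (suc p) q (nbrs-unique (not b) v u) large₂
  ...   | inj₁ cl = inj₁ (clique-⊆ (there ∘ nbrs-⊆ (not b) v U) cl)
  ...   | inj₂ cl = inj₂ (clique-∷ (here refl) (there ∘ nbrs-⊆ (not b) v U) (all-filter (edge? (not b) v) U) cl)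

  clique⇒copy : ∀ {b m} → HasClique b m (allFin N) → MonochromaticCopy (K m) κ
  clique⇒copy {b} (xs , refl , pairs , _) = b , lookup xs , inj , λ u v u≢v → proj₂ (edge u v u≢v)
    where
    edge : ∀ u v → u ≢ v → Edge b (lookup xs u) (lookup xs v)
    edge = AllPairs-lookup edge-sym pairs
    inj : Injective _≡_ _≡_ (lookup xs)
    inj {u} {v} eq with u Fin.≟ v
    ... | yes u≡v = u≡v
    ... | no  u≢v = contradiction eq (proj₁ (edge u v u≢v))

  -- The colouring is pulled back along the first `M` entries of `U`, which are distinct.
  ramsey⇒clique : ∀ {m M} → Ramsey (K m) M → ∀ {U} → Unique U → M ≤ length U →
                  ∃[ b ] HasClique b m U
  ramsey⇒clique {m} {M} ramsey {U} u M≤U = b , map f (allFin m) , len , pairs , mem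
    where
    ι : Fin M → Fin N
    ι i = lookup U (inject≤ i M≤U)
    ι-injective : ∀ {i j} → ι i ≡ ι j → i ≡ j
    ι-injective = Fin.inject≤-injective M≤U M≤U _ _ ∘ Unique-lookup-injective u
    copy = ramsey record { colour = λ i j → colour κ (ι i) (ι j) ; colour-sym = λ i j → EdgeColouring.colour-sym κ (ι i) (ι j) }
    b = proj₁ copy
    φ = proj₁ (proj₂ copy)
    f = ι ∘ φ
    len : length (map f (allFin m)) ≡ m
    len = trans (length-map f (allFin m)) (length-tabulate id)
    pairs : AllPairs (Edge b) (map f (allFin m))
    pairs = AllPairs.map⁺ (AllPairs.tabulate⁺ λ {i} {j} i≢j →
      i≢j ∘ proj₁ (proj₂ (proj₂ copy)) ∘ ι-injective , proj₂ (proj₂ (proj₂ copy)) i j i≢j)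
    mem : map f (allFin m) ⊆ U
    mem x∈ with _ , _ , refl ← ∈-map⁻ f x∈ = ∈-lookup {xs = U} _

-- The ratio of consecutive Ramsey numbers of complete graphs.

module Extension {N : ℕ} (κ : EdgeColouring N) where

  open Cliques κ

  -- Pigeonhole on the sets of neighbours in T: there are at most binom t s of them.
  common-neighbours : ∀ b t s q T {W} → length T ≤ t → Unique W →
    (∀ {w} → w ∈ W → degree (nonEdge? b) T w ≤ s) → binom t s * q < length W →
    ∃[ T′ ] ∃[ W′ ] T′ ⊆ T × length T ≤ s + length T′ × (AllPairs (Edge b) T → AllPairs (Edge b) T′) ×
      W′ ⊆ W × Unique W′ × q < length W′ × (∀ {t w} → t ∈ T′ → w ∈ W′ → Edge b t w)
  common-neighbours b t s q [] {W} _ u _ large =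
    [] , W , (λ ()) , z≤n , id , id , u ,
    ≤-<-trans (≤-trans (≤-reflexive (sym (*-identityˡ q))) (*-monoˡ-≤ q (binom-≥1 t s))) large , λ ()
  common-neighbours b (suc t) s q (x ∷ T) {W} (s≤s len) u deg large
    with binom t s * q <? length (nbrs b x W)
  ... | yes large₁
    with T′ , W′ , T′⊆ , len′ , pairs , W′⊆ , u′ , large′ , e ←
      common-neighbours b t s q T len (nbrs-unique b x u) (≤-trans (degree-mono (nonEdge? b) x T _) ∘ deg ∘ nbrs-⊆ b x W) large₁
    = x ∷ T′ , W′ , (λ { (here eq) → here eq ; (there ∈T) → there (T′⊆ ∈T) }) ,
      ≤-trans (s≤s len′) (≤-reflexive (sym (+-suc s _))) ,
      (λ { (x~T ∷ ps) → All.tabulate (All.lookup x~T ∘ T′⊆) ∷ pairs ps }) ,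
      nbrs-⊆ b x W ∘ W′⊆ , u′ , large′ ,
      λ { (here refl) ∈W → proj₂ (∈-filter⁻ (edge? b x) {xs = W} (W′⊆ ∈W)) ; (there ∈T) ∈W → e ∈T ∈W }
  common-neighbours b (suc t) zero q (x ∷ T) {W} (s≤s len) u deg large | no small = contradiction large (≤⇒≯ (begin
    length W                                              ≤⟨ count-cover¬ (edge? b x) W ⟩
    length (nbrs b x W) + count (nonEdge? b x) W          ≡⟨ cong (length (nbrs b x W) +_) (cong length noNonEdges) ⟩
    length (nbrs b x W) + 0                               ≡⟨ +-identityʳ _ ⟩
    length (nbrs b x W)                                   ≤⟨ ≮⇒≥ small ⟩
    binom t 0 * q                                         ≤⟨ *-monoˡ-≤ q (binom-monoˡ t 0) ⟩
    binom (suc t) 0 * q                                   ∎))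
    where
    noNonEdges : filter (nonEdge? b x) W ≡ []
    noNonEdges = filter-none (nonEdge? b x) (All.tabulate λ w∈ ¬e →
      contradiction (≤-trans (≤-reflexive (sym (degree-suc (nonEdge? b) x T ¬e))) (deg w∈)) λ ())
  -- Few vertices of `W` are joined to `x`, so `x` is dropped and the rest have one miss less to
  -- spend. The bound `suc t` on the length of `T` is kept, so that the two cases add up to the
  -- recurrence of `binom`.
  common-neighbours b (suc t) (suc s) q (x ∷ T) {W} (s≤s len) u deg large | no small
    with T′ , W′ , T′⊆ , len′ , pairs , W′⊆ , rest ←
      common-neighbours b (suc t) s q T (m≤n⇒m≤1+n len) (filter⁺ (nonEdge? b x) u)
        (λ {w} w∈ → let w∈W , ¬e = ∈-filter⁻ (nonEdge? b x) {xs = W} w∈ in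
          s≤s⁻¹ (≤-trans (≤-reflexive (sym (degree-suc (nonEdge? b) x T ¬e))) (deg w∈W)))
        (+-cancelˡ-< (binom t (suc s) * q) _ _ (begin-strict
          binom t (suc s) * q + binom (suc t) s * q           ≡⟨ *-distribʳ-+ q (binom t (suc s)) _ ⟨
          binom (suc t) (suc s) * q                           <⟨ large ⟩
          length W                                            ≤⟨ count-cover¬ (edge? b x) W ⟩
          length (nbrs b x W) + count (nonEdge? b x) W        ≤⟨ +-monoˡ-≤ _ (≮⇒≥ small) ⟩
          binom t (suc s) * q + count (nonEdge? b x) W        ∎))
    = T′ , W′ , there ∘ T′⊆ , s≤s len′ , (λ { (_ ∷ ps) → pairs ps }) ,
      proj₁ ∘ ∈-filter⁻ (nonEdge? b x) {xs = W} ∘ W′⊆ , rest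

  clique-++ : ∀ {b m W U} T → AllPairs (Edge b) T → T ⊆ U → W ⊆ U → (∀ {t w} → t ∈ T → w ∈ W → Edge b t w) →
              HasClique b m W → HasClique b (length T + m) U
  clique-++ T pairs T⊆U W⊆U T~W (xs , refl , pairs′ , xs⊆W) =
    T ++ xs , length-++ T ,
    AllPairs.++⁺ pairs pairs′ (All.tabulate λ t∈ → All.tabulate (T~W t∈ ∘ xs⊆W)) ,
    [ T⊆U , W⊆U ∘ xs⊆W ]′ ∘ ∈-++⁻ T

  module _ (b : Bool) {e m M s : ℕ} {A : List (Fin N)} (u : Unique A) (m<es : m < e * suc s)
           (M-large : binom m s * binom m s < M) (A-large : suc e * M ≤ length A)
           (deg : ∀ {t} → t ∈ A → count (nonEdge? b t) A ≤ M)
           (noClique : ¬ HasClique (not b) (suc m) A) where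

    few? : ∀ T → Decidable (λ w → degree (nonEdge? b) T w ≤ s)
    few? T w = degree (nonEdge? b) T w ≤? s

    -- Between `T` and `A` at most `m * M` edges are missing, which is less than `e * suc s * M`. So
    -- at most `e * M` vertices of `A` can miss more than `s` vertices of `T`.
    few-large : ∀ {T} → T ⊆ A → length T ≤ m → M ≤ count (few? T) A
    few-large {T} T⊆A T≤m = +-cancelʳ-≤ (e * M) M _ (begin
      M + e * M                                        ≤⟨ A-large ⟩
      length A                                          ≤⟨ count-cover¬ (few? T) A ⟩
      count (few? T) A + count (¬? ∘ few? T) A          ≤⟨ +-monoʳ-≤ (count (few? T) A) many-small ⟩
      count (few? T) A + e * M                         ∎)
      where
      many-small : count (¬? ∘ few? T) A ≤ e * M
      many-small = *-cancelˡ-≤ (suc s) (begin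
        suc s * count (¬? ∘ few? T) A           ≤⟨ markov (¬? ∘ few? T) (degree (nonEdge? b) T) (suc s) ≰⇒> A ⟩
        sum (map (degree (nonEdge? b) T) A)     ≤⟨ sum-degree-≤ (nonEdge? b) T A (All.tabulate (deg ∘ T⊆A)) ⟩
        length T * M                            ≤⟨ *-monoˡ-≤ M (≤-trans T≤m (<⇒≤ m<es)) ⟩
        e * suc s * M                          ≡⟨ cong (_* M) (*-comm e (suc s)) ⟩
        suc s * e * M                          ≡⟨ *-assoc (suc s) e M ⟩
        suc s * (e * M)                        ∎)

    -- Erdős–Szemerédi: most vertices of A miss at most s vertices of T, hence many of them miss
    -- the same set S of at most s vertices; a b-clique of s + 1 of those can replace S.
    clique-suc : ∀ {j} → j ≤ m → HasClique b j A → HasClique b (suc j) A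
    clique-suc j≤m (T , refl , pairs , T⊆A)
      with T′ , W′ , T′⊆ , len′ , pairs′ , W′⊆ , u′ , large′ , T′~W′ ←
        common-neighbours b m s (binom m s) T j≤m (filter⁺ (few? T) u)
          (proj₂ ∘ ∈-filter⁻ (few? T) {xs = A}) (<-≤-trans M-large (few-large T⊆A j≤m))
      with erdős-szekeres (not b) m s u′ (<⇒≤ large′)
    ... | inj₁ cl = contradiction (clique-⊆ (proj₁ ∘ ∈-filter⁻ (few? T) {xs = A} ∘ W′⊆) cl) noClique
    ... | inj₂ cl = clique-≤ (≤-trans (s≤s len′) (≤-reflexive (trans (cong suc (+-comm s _)) (sym (+-suc _ s)))))
      (clique-++ T′ (pairs′ pairs) (T⊆A ∘ T′⊆) (proj₁ ∘ ∈-filter⁻ (few? T) {xs = A} ∘ W′⊆) T′~W′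
        (subst (λ c → HasClique c (suc s) W′) (Bool.not-involutive b) cl))

    clique : ∀ j → j ≤ suc m → HasClique b j A
    clique zero    _         = [] , refl , [] , λ ()
    clique (suc j) (s≤s j≤m) = clique-suc j≤m (clique j (m≤n⇒m≤1+n j≤m))

  sparse-neighbours : ∀ {m M} → Ramsey (K m) M → ∀ b {v U} → Unique U → v ∈ U →
    (∀ c → ¬ HasClique c (suc m) U) →
    ∀ {t} → t ∈ nbrs b v U → count (nonEdge? b t) (nbrs b v U) ≤ M
  sparse-neighbours {m} {M} ramsey b {v} {U} u v∈U noClique {t} t∈A = begin
    -- `t` is a non-neighbour of itself; the strict bound `few` on the others makes room for it.
    count (nonEdge? b t) A              ≤⟨ unique-⊆⇒≤ Fin._≟_ (filter⁺ (nonEdge? b t) uA) (t ∷ nbrs (not b) t A) split ⟩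
    suc (length (nbrs (not b) t A))     ≤⟨ ≰⇒> few ⟩
    M                                   ∎
    where
    A = nbrs b v U
    A⊆U = nbrs-⊆ b v U
    uA = nbrs-unique b v u
    B⊆A = nbrs-⊆ (not b) t A
    split : filter (nonEdge? b t) A ⊆ t ∷ nbrs (not b) t A
    split {w} w∈ with w∈A , ¬e ← ∈-filter⁻ (nonEdge? b t) {xs = A} w∈ with t Fin.≟ w
    ... | yes t≡w = here (sym t≡w)
    ... | no  t≢w = there (∈-filter⁺ (edge? (not b) t) w∈A ([ (λ e → contradiction e ¬e) , id ]′ (edge-total b t≢w)))
    few : ¬ (M ≤ length (nbrs (not b) t A))
    few large with c , cl ← ramsey⇒clique ramsey (nbrs-unique (not b) t uA) large with c Bool.≟ b
    ... | yes refl = noClique b (clique-∷ v∈U (A⊆U ∘ B⊆A)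
            (All.tabulate (proj₂ ∘ ∈-filter⁻ (edge? b v) {xs = U} ∘ B⊆A)) cl)
    ... | no c≢b with refl ← Bool.¬-not c≢b = noClique (not b) (clique-∷ (A⊆U t∈A) (A⊆U ∘ B⊆A)
            (all-filter (edge? (not b) t) A) cl)

  -- One colour has at least `suc e * M` neighbours at the first vertex. The absence of cliques is
  -- used throughout the extension argument, hence the doubly negated conclusion; `ramsey-ratio`
  -- removes the negations by decidability of copies.
  ratio-core : ∀ {e m M s} → Ramsey (K m) M → m < e * suc s → binom m s * binom m s < M →
               ∀ {U} → Unique U → suc e * M + suc e * M ≤ length U → ¬ (∀ c → ¬ HasClique c (suc m) U)
  ratio-core {e} {m} {M} {s} ramsey m<es M-large {[]} u large noClique =
    contradiction (≤-trans (<-≤-trans M-large (≤-trans (m≤m+n M (e * M)) (m≤m+n _ _))) large) λ ()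
  ratio-core {e} {m} {M} {s} ramsey m<es M-large {v ∷ U} u@(v∉U ∷ _) large noClique
    = [ go true , go false ]′
      (split-+ {suc e * M} {suc e * M} (≤-trans large (s≤s (nbrs-cover true v∉U))))
    where
    go : ∀ b → suc e * M ≤ length (nbrs b v U) → _
    go b large = noClique b (clique-⊆ (nbrs-⊆ b v (v ∷ U)) (clique b {e} {s = s} (nbrs-unique b v u) m<es M-large
      (≤-trans large (count-∷ (edge? b v) v U)) (sparse-neighbours ramsey b u (here refl) noClique)
      (noClique (not b) ∘ clique-⊆ (nbrs-⊆ b v (v ∷ U))) (suc m) ≤-refl))

-- The lower bound on Ramsey numbers of complete graphs by the probabilistic method.

-- A subcube of the assignments, with `nothing` at the free coordinates. It contains `2 ^ free c`
-- assignments, so `weight` is `2 ^ e` times the expected number of constraints satisfied by a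
-- random assignment.
Constraint : ℕ → Set
Constraint = Vec (Maybe Bool)

Satisfies : ∀ {e} → Constraint e → (Fin e → Bool) → Set
Satisfies []            a = ⊤
Satisfies (nothing ∷ c) a = Satisfies c (a ∘ suc)
Satisfies (just b  ∷ c) a = a zero ≡ b × Satisfies c (a ∘ suc)

free : ∀ {e} → Constraint e → ℕ
free []            = 0
free (nothing ∷ c) = suc (free c)
free (just _  ∷ c) = free c

weight : ∀ {e} → List (Constraint e) → ℕ
weight []      = 0
weight (c ∷ L) = 2 ^ free c + weight L

restrict : ∀ {e} → Bool → List (Constraint (suc e)) → List (Constraint e)
restrict b     []                       = []
restrict b     ((nothing    ∷ c) ∷ L) = c ∷ restrict b L
restrict true  ((just true  ∷ c) ∷ L) = c ∷ restrict true L
restrict true  ((just false ∷ c) ∷ L) = restrict true L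
restrict false ((just true  ∷ c) ∷ L) = restrict false L
restrict false ((just false ∷ c) ∷ L) = c ∷ restrict false L

-- The method of conditional expectations: one of the two values of the first coordinate leaves at
-- most half the weight, so `avoid` can fix the coordinates one at a time.
weight-restrict : ∀ {e} (L : List (Constraint (suc e))) →
                  weight (restrict true L) + weight (restrict false L) ≡ weight L
weight-restrict [] = refl
weight-restrict ((nothing ∷ c) ∷ L) = trans (interchange (2 ^ free c) (weight (restrict true L)) (2 ^ free c) _)
  (cong₂ _+_ (cong (2 ^ free c +_) (sym (+-identityʳ _))) (weight-restrict L))
weight-restrict ((just true ∷ c) ∷ L) = trans (+-assoc (2 ^ free c) _ _) (cong (2 ^ free c +_) (weight-restrict L))
weight-restrict ((just false ∷ c) ∷ L) =
  trans (x∙yz≈y∙xz (weight (restrict true L)) (2 ^ free c) _) (cong (2 ^ free c +_) (weight-restrict L))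

violate-restrict : ∀ {e} b (a : Fin e → Bool) L → All (λ c → ¬ Satisfies c a) (restrict b L) →
                   All (λ c → ¬ Satisfies c (b Functional.∷ a)) L
violate-restrict b     a []                     []         = []
violate-restrict b     a ((nothing    ∷ c) ∷ L) (¬s ∷ ¬ss) = ¬s ∷ violate-restrict b a L ¬ss
violate-restrict true  a ((just true  ∷ c) ∷ L) (¬s ∷ ¬ss) = ¬s ∘ proj₂ ∷ violate-restrict true a L ¬ss
violate-restrict true  a ((just false ∷ c) ∷ L) ¬ss        = (λ { (() , _) }) ∷ violate-restrict true a L ¬ss
violate-restrict false a ((just true  ∷ c) ∷ L) ¬ss        = (λ { (() , _) }) ∷ violate-restrict false a L ¬ss
violate-restrict false a ((just false ∷ c) ∷ L) (¬s ∷ ¬ss) = ¬s ∘ proj₂ ∷ violate-restrict false a L ¬ss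

-- The union bound: a random assignment satisfies c with probability 2 ^ free c / 2 ^ e.
avoid : ∀ {e} (L : List (Constraint e)) → weight L < 2 ^ e → ∃[ a ] All (λ c → ¬ Satisfies c a) L
avoid {zero}  []       _ = (λ ()) , []
avoid {zero}  ([] ∷ L) (s≤s ())
avoid {suc e} L small with weight (restrict true L) <? 2 ^ e
... | yes small₁ with a , ¬ss ← avoid (restrict true L) small₁ = _ , violate-restrict true a L ¬ss
... | no large with a , ¬ss ← avoid (restrict false L) (+-cancelˡ-< (2 ^ e) _ _ (begin-strict
    2 ^ e + weight (restrict false L)                    ≤⟨ +-monoˡ-≤ _ (≮⇒≥ large) ⟩
    weight (restrict true L) + weight (restrict false L) ≡⟨ weight-restrict L ⟩
    weight L                                             <⟨ small ⟩
    2 ^ e + (2 ^ e + 0)                                  ≡⟨ cong (2 ^ e +_) (+-identityʳ _) ⟩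
    2 ^ e + 2 ^ e                                        ∎)) = _ , violate-restrict false a L ¬ss

weight-uniform : ∀ {e} k (L : List (Constraint e)) → All (λ c → free c + k ≡ e) L → weight L * 2 ^ k ≡ length L * 2 ^ e
weight-uniform k [] [] = refl
weight-uniform k (c ∷ L) (eq ∷ eqs) = trans (*-distribʳ-+ (2 ^ k) (2 ^ free c) _)
  (cong₂ _+_ (trans (sym (^-distribˡ-+-* 2 (free c) k)) (cong (2 ^_) eq)) (weight-uniform k L eqs))

-- The number of edges of `K n`, that is n(n - 1)/2.
tri : ℕ → ℕ
tri zero    = 0
tri (suc n) = n + tri n

2tri : ∀ m → tri m + tri m + m ≡ m * m
2tri zero    = refl
2tri (suc m) = trans (lemma m (tri m)) (trans (cong (λ z → z + m + suc m) (2tri m)) (lemma′ m))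
  where
  open +-*-Solver
  lemma : ∀ m t → (m + t) + (m + t) + suc m ≡ (t + t + m) + m + suc m
  lemma = solve 2 (λ m t → (m :+ t) :+ (m :+ t) :+ (con 1 :+ m) := (t :+ t :+ m) :+ m :+ (con 1 :+ m)) refl
  lemma′ : ∀ m → m * m + m + suc m ≡ suc m * suc m
  lemma′ = solve 1 (λ m → m :* m :+ m :+ (con 1 :+ m) := (con 1 :+ m) :* (con 1 :+ m)) refl

size : ∀ {n} → Vec Bool n → ℕ
size []          = 0
size (true  ∷ S) = suc (size S)
size (false ∷ S) = size S

subsets : ∀ n → ℕ → List (Vec Bool n)
subsets zero    zero    = [] ∷ []
subsets zero    (suc m) = []
subsets (suc n) zero    = map (false ∷_) (subsets n zero)
subsets (suc n) (suc m) = map (true ∷_) (subsets n m) ++ map (false ∷_) (subsets n (suc m))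

∈-subsets : ∀ {n} (S : Vec Bool n) → S ∈ subsets n (size S)
∈-subsets []         = here refl
∈-subsets (true ∷ S) = ∈-++⁺ˡ (∈-map⁺ (true ∷_) (∈-subsets S))
∈-subsets (false ∷ S) with size S | ∈-subsets S
... | zero  | S∈ = ∈-map⁺ (false ∷_) S∈
... | suc m | S∈ = ∈-++⁺ʳ (map (true ∷_) (subsets _ m)) (∈-map⁺ (false ∷_) S∈)

subsets-size : ∀ n m → All (λ S → size S ≡ m) (subsets n m)
subsets-size zero    zero    = refl ∷ []
subsets-size zero    (suc m) = []
subsets-size (suc n) zero    = All.map⁺ (subsets-size n zero)
subsets-size (suc n) (suc m) =
  All.++⁺ (All.map⁺ (All.map (cong suc) (subsets-size n m))) (All.map⁺ (subsets-size n (suc m)))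

length-subsets : ∀ n m → length (subsets n m) ≤ n ^ m
length-subsets zero    zero    = ≤-refl
length-subsets zero    (suc m) = z≤n
length-subsets (suc n) zero    = ≤-trans (≤-reflexive (length-map _ (subsets n zero))) (length-subsets n zero)
length-subsets (suc n) (suc m) = begin
  length (map (true ∷_) (subsets n m) ++ map (false ∷_) (subsets n (suc m)))  ≡⟨ length-++ (map (true ∷_) (subsets n m)) ⟩
  length (map (true ∷_) (subsets n m)) + length (map (false ∷_) (subsets n (suc m)))
    ≡⟨ cong₂ _+_ (length-map _ (subsets n m)) (length-map _ (subsets n (suc m))) ⟩
  length (subsets n m) + length (subsets n (suc m))  ≤⟨ +-mono-≤ (length-subsets n m) (length-subsets n (suc m)) ⟩
  n ^ m + n * n ^ m                                  ≤⟨ *-monoʳ-≤ (suc n) (^-monoˡ-≤ m (n≤1+n n)) ⟩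
  suc n * suc n ^ m                                  ∎

-- The edges of K n are listed vertex by vertex, each vertex with the edges to its successors; mono b S
-- says that all edges inside S have colour b.
row : ∀ {n} → Bool → Bool → Vec Bool n → Constraint n
row b s = Vec.map (λ x → if s ∧ x then just b else nothing)

mono : ∀ {n} → Bool → Vec Bool n → Constraint (tri n)
mono b []      = []
mono b (s ∷ S) = row b s S Vec.++ mono b S

free-++ : ∀ {d e} (c : Constraint d) (c′ : Constraint e) → free (c Vec.++ c′) ≡ free c + free c′
free-++ []            c′ = refl
free-++ (nothing ∷ c) c′ = cong suc (free-++ c c′)
free-++ (just _  ∷ c) c′ = free-++ c c′

free-row-false : ∀ {n} b (S : Vec Bool n) → free (row b false S) ≡ n
free-row-false b []      = refl
free-row-false b (_ ∷ S) = cong suc (free-row-false b S)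

free-row-true : ∀ {n} b (S : Vec Bool n) → free (row b true S) + size S ≡ n
free-row-true b []          = refl
free-row-true b (true  ∷ S) = trans (+-suc _ (size S)) (cong suc (free-row-true b S))
free-row-true b (false ∷ S) = cong suc (free-row-true b S)

free-mono : ∀ {n} b (S : Vec Bool n) → free (mono b S) + tri (size S) ≡ tri n
free-mono b [] = refl
free-mono b (true ∷ S) = trans (cong (_+ (size S + tri (size S))) (free-++ (row b true S) (mono b S)))
  (trans (interchange (free (row b true S)) (free (mono b S)) (size S) _) (cong₂ _+_ (free-row-true b S) (free-mono b S)))
free-mono b (false ∷ S) = trans (cong (_+ tri (size S)) (free-++ (row b false S) (mono b S)))
  (trans (+-assoc (free (row b false S)) _ _) (cong₂ _+_ (free-row-false b S) (free-mono b S)))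

triColour : ∀ n → (Fin (tri n) → Bool) → Fin n → Fin n → Bool
triColour (suc n) a zero    zero    = true
triColour (suc n) a zero    (suc j) = a (j ↑ˡ tri n)
triColour (suc n) a (suc i) zero    = a (i ↑ˡ tri n)
triColour (suc n) a (suc i) (suc j) = triColour n (a ∘ (n ↑ʳ_)) i j

triColour-sym : ∀ n a i j → triColour n a i j ≡ triColour n a j i
triColour-sym (suc n) a zero    zero    = refl
triColour-sym (suc n) a zero    (suc j) = refl
triColour-sym (suc n) a (suc i) zero    = refl
triColour-sym (suc n) a (suc i) (suc j) = triColour-sym n (a ∘ (n ↑ʳ_)) i j

triColouring : ∀ {n} → (Fin (tri n) → Bool) → EdgeColouring n
triColouring {n} a = record { colour = triColour n a ; colour-sym = triColour-sym n a }

satisfies-++ : ∀ {d e} (c : Constraint d) (c′ : Constraint e) {a} →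
               Satisfies c (a ∘ (_↑ˡ e)) → Satisfies c′ (a ∘ (d ↑ʳ_)) → Satisfies (c Vec.++ c′) a
satisfies-++ []            c′ s        s′ = s′
satisfies-++ (nothing ∷ c) c′ s        s′ = satisfies-++ c c′ s s′
satisfies-++ (just _  ∷ c) c′ (eq , s) s′ = eq , satisfies-++ c c′ s s′

satisfies-row : ∀ {n} b s (S : Vec Bool n) {a} → (∀ j → s ≡ true → Vec.lookup S j ≡ true → a j ≡ b) →
                Satisfies (row b s S) a
satisfies-row b s     []          h = tt
satisfies-row b true  (true  ∷ S) h = h zero refl refl , satisfies-row b true S (h ∘ suc)
satisfies-row b true  (false ∷ S) h = satisfies-row b true S (h ∘ suc)
satisfies-row b false (x     ∷ S) h = satisfies-row b false S (λ _ ())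

satisfies-mono : ∀ {n} b (S : Vec Bool n) {a} →
  (∀ i j → i ≢ j → Vec.lookup S i ≡ true → Vec.lookup S j ≡ true → triColour _ a i j ≡ b) → Satisfies (mono b S) a
satisfies-mono b []      h = tt
satisfies-mono b (s ∷ S) h = satisfies-++ (row b s S) (mono b S)
  (satisfies-row b s S λ j → h zero (suc j) λ ())
  (satisfies-mono b S λ i j i≢j → h (suc i) (suc j) (i≢j ∘ Fin.suc-injective))

setOf : ∀ {n} → List (Fin n) → Vec Bool n
setOf []       = Vec.replicate _ false
setOf (x ∷ xs) = setOf xs Vec.[ x ]≔ true

∈-setOf⁻ : ∀ {n} (xs : List (Fin n)) {i} → Vec.lookup (setOf xs) i ≡ true → i ∈ xs
∈-setOf⁻ [] {i} eq = contradiction (trans (sym (Vec.lookup-replicate i false)) eq) λ ()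
∈-setOf⁻ (x ∷ xs) {i} eq with i Fin.≟ x
... | yes i≡x = here i≡x
... | no  i≢x = there (∈-setOf⁻ xs (trans (sym (Vec.lookup∘updateAt′ i x i≢x (setOf xs))) eq))

size-insert : ∀ {n} (S : Vec Bool n) x → Vec.lookup S x ≡ false → size (S Vec.[ x ]≔ true) ≡ suc (size S)
size-insert (false ∷ S) zero    refl = refl
size-insert (true  ∷ S) (suc x) eq   = cong suc (size-insert S x eq)
size-insert (false ∷ S) (suc x) eq   = size-insert S x eq

size-∅ : ∀ n → size (Vec.replicate n false) ≡ 0
size-∅ zero    = refl
size-∅ (suc n) = size-∅ n

size-setOf : ∀ {n} {xs : List (Fin n)} → Unique xs → size (setOf xs) ≡ length xs
size-setOf {n} [] = size-∅ n
size-setOf {xs = x ∷ xs} u@(_ ∷ u′) =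
  trans (size-insert (setOf xs) x (Bool.¬-not (Unique[x∷xs]⇒x∉xs u ∘ ∈-setOf⁻ xs))) (cong suc (size-setOf u′))

-- Erdős' counting bound: if it failed, the events "this `m`-set is monochromatic in this colour"
-- would weigh less than `2 ^ tri M` in total, and `avoid` would give a colouring without a copy.
-- Counting `m`-sets by `M ^ m` rather than by a binomial coefficient costs only a factor of order m
-- in the resulting bound on `M`.
ramsey-lower : ∀ {m M} → Ramsey (K m) M → 2 ^ tri m ≤ 2 * M ^ m
ramsey-lower {m} {M} ramsey with 2 ^ tri m ≤? 2 * M ^ m
... | yes le = le
... | no nle = contradiction (ramsey (triColouring a)) noCopy
  where
  events : List (Constraint (tri M))
  events = map (mono true) (subsets M m) ++ map (mono false) (subsets M m)

  length-events : length events ≡ 2 * length (subsets M m)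
  length-events = trans (length-++ (map (mono true) (subsets M m)))
    (cong₂ _+_ (length-map _ (subsets M m)) (trans (length-map _ (subsets M m)) (sym (+-identityʳ _))))

  free-events : All (λ c → free c + tri m ≡ tri M) events
  free-events = All.++⁺ (All.map⁺ (uniform true)) (All.map⁺ (uniform false))
    where
    uniform : ∀ b → All (λ S → free (mono b S) + tri m ≡ tri M) (subsets M m)
    uniform b = All.map (λ {S} → λ { refl → free-mono b S }) (subsets-size M m)

  light : weight events < 2 ^ tri M
  light = *-cancelʳ-< (2 ^ tri m) (weight events) (2 ^ tri M) (begin-strict
    weight events * 2 ^ tri m                ≡⟨ weight-uniform (tri m) events free-events ⟩
    length events * 2 ^ tri M                ≡⟨ cong (_* 2 ^ tri M) length-events ⟩
    2 * length (subsets M m) * 2 ^ tri M     ≤⟨ *-monoˡ-≤ (2 ^ tri M) (*-monoʳ-≤ 2 (length-subsets M m)) ⟩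
    2 * M ^ m * 2 ^ tri M                    <⟨ *-monoˡ-< (2 ^ tri M) {{m^n≢0 2 (tri M)}} (≰⇒> nle) ⟩
    2 ^ tri m * 2 ^ tri M                    ≡⟨ *-comm (2 ^ tri m) _ ⟩
    2 ^ tri M * 2 ^ tri m                    ∎)

  a : Fin (tri M) → Bool
  a = proj₁ (avoid events light)

  noCopy : ¬ MonochromaticCopy (K m) (triColouring a)
  noCopy (b , φ , inj , same) = All.lookup (proj₂ (avoid events light)) (event b) (satisfies-mono b S all-same)
    where
    S : Vec Bool M
    S = setOf (tabulate φ)
    all-same : ∀ i j → i ≢ j → Vec.lookup S i ≡ true → Vec.lookup S j ≡ true → triColour _ a i j ≡ b
    all-same i j i≢j i∈ j∈ with u , refl ← ∈-tabulate⁻ (∈-setOf⁻ (tabulate φ) i∈)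
                              | v , refl ← ∈-tabulate⁻ (∈-setOf⁻ (tabulate φ) j∈) = same u v (i≢j ∘ cong φ)
    S∈ : S ∈ subsets M m
    S∈ = subst (λ k → S ∈ subsets M k) (trans (size-setOf (tabulate⁺ inj)) (length-tabulate φ)) (∈-subsets S)
    event : ∀ b → mono b S ∈ events
    event true  = ∈-++⁺ˡ (∈-map⁺ (mono true) S∈)
    event false = ∈-++⁺ʳ (map (mono true) (subsets M m)) (∈-map⁺ (mono false) S∈)

-- Numerical comparison of the upper and lower bounds.

^-distribʳ-* : ∀ n x y → (x * y) ^ n ≡ x ^ n * y ^ n
^-distribʳ-* zero    x y = refl
^-distribʳ-* (suc n) x y = trans (cong (x * y *_) (^-distribʳ-* n x y)) (*-Semigroup.interchange x y (x ^ n) (y ^ n))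

^-comm : ∀ a x y → (a ^ x) ^ y ≡ (a ^ y) ^ x
^-comm a x y = trans (^-*-assoc a x y) (trans (cong (a ^_) (*-comm x y)) (sym (^-*-assoc a y x)))

-- The left side is a single term of the binomial expansion of `(D + 1) ^ (a + b)`.
binom-^ : ∀ D a b → binom a b * D ^ a ≤ suc D ^ (a + b)
binom-^ D zero    b       = m^n>0 (suc D) b
binom-^ D (suc a) zero    = begin
  1 * D ^ suc a          ≡⟨ *-identityˡ _ ⟩
  D ^ suc a              ≤⟨ ^-monoˡ-≤ (suc a) (n≤1+n D) ⟩
  suc D ^ suc a          ≡⟨ cong (suc D ^_) (+-identityʳ (suc a)) ⟨
  suc D ^ (suc a + 0)    ∎
binom-^ D (suc a) (suc b) = begin
  (binom a (suc b) + binom (suc a) b) * (D * D ^ a)              ≡⟨ *-distribʳ-+ (D * D ^ a) (binom a (suc b)) _ ⟩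
  binom a (suc b) * (D * D ^ a) + binom (suc a) b * (D * D ^ a)  ≡⟨ cong (_+ binom (suc a) b * D ^ suc a) (*-Semigroup.x∙yz≈y∙xz (binom a (suc b)) D (D ^ a)) ⟩
  D * (binom a (suc b) * D ^ a) + binom (suc a) b * D ^ suc a    ≤⟨ +-mono-≤ (*-monoʳ-≤ D (binom-^ D a (suc b))) (binom-^ D (suc a) b) ⟩
  D * suc D ^ (a + suc b) + suc D ^ suc (a + b)                  ≡⟨ cong (λ e → D * suc D ^ e + suc D ^ suc (a + b)) (+-suc a b) ⟩
  D * suc D ^ suc (a + b) + suc D ^ suc (a + b)                  ≡⟨ +-comm (D * suc D ^ suc (a + b)) _ ⟩
  suc D ^ suc (suc (a + b))                                      ≡⟨ cong (λ e → suc D ^ suc e) (+-suc a b) ⟨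
  suc D ^ (suc a + suc b)                                        ∎

-- 17 ^ 11 ≤ 2 ^ 45 turns binom-^ at D = 16 into a bound by a small power of two.
binom-^11 : ∀ m s → 45 * s ≤ m → binom m s ^ 11 ≤ 2 ^ (m + m)
binom-^11 m s 45s≤m = *-cancelʳ-≤ _ _ (2 ^ (44 * m)) {{m^n≢0 2 (44 * m)}} (begin
  binom m s ^ 11 * 2 ^ (44 * m)       ≡⟨ cong (binom m s ^ 11 *_) 2^44m ⟩
  binom m s ^ 11 * (16 ^ m) ^ 11      ≡⟨ ^-distribʳ-* 11 (binom m s) (16 ^ m) ⟨
  (binom m s * 16 ^ m) ^ 11           ≤⟨ ^-monoˡ-≤ 11 (binom-^ 16 m s) ⟩
  (17 ^ (m + s)) ^ 11                 ≡⟨ ^-comm 17 (m + s) 11 ⟩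
  (17 ^ 11) ^ (m + s)                 ≤⟨ ^-monoˡ-≤ (m + s) (≤ᵇ⇒≤ (17 ^ 11) (2 ^ 45) tt) ⟩
  (2 ^ 45) ^ (m + s)                  ≡⟨ ^-*-assoc 2 45 (m + s) ⟩
  2 ^ (45 * (m + s))                  ≡⟨ cong (2 ^_) (*-distribˡ-+ 45 m s) ⟩
  2 ^ (45 * m + 45 * s)               ≤⟨ ^-monoʳ-≤ 2 (+-monoʳ-≤ (45 * m) 45s≤m) ⟩
  2 ^ (m + 44 * m + m)                ≡⟨ cong (2 ^_) (trans (+-assoc m (44 * m) m) (trans (cong (m +_) (+-comm (44 * m) m)) (sym (+-assoc m m (44 * m))))) ⟩
  2 ^ (m + m + 44 * m)                ≡⟨ ^-distribˡ-+-* 2 (m + m) (44 * m) ⟩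
  2 ^ (m + m) * 2 ^ (44 * m)          ∎)
  where
  2^44m : 2 ^ (44 * m) ≡ (16 ^ m) ^ 11
  2^44m = trans (sym (^-*-assoc 2 44 m)) (trans (cong (_^ m) {x = 2 ^ 44} {y = 16 ^ 11} refl) (^-comm 16 11 m))

-- Since `tri m` is (m² - m)/2, the inequality amounts to 3m² ≤ 22 + 11m, which holds at m = 5 and
-- fails from 6 on.
tri-large : ∀ m → 6 ≤ m → ¬ (11 * tri m ≤ 11 + 4 * (m * m))
tri-large m 6≤m le = contradiction (*-monoʳ-≤ 7 6≤m) (<⇒≱ (s≤s (begin
  7 * m        ≤⟨ +-cancelʳ-≤ (11 * m) (7 * m) 22 (begin
    7 * m + 11 * m        ≡⟨ *-distribʳ-+ m 7 11 ⟨
    18 * m                ≡⟨ *-assoc 3 6 m ⟩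
    3 * (6 * m)           ≤⟨ *-monoʳ-≤ 3 (*-monoˡ-≤ m 6≤m) ⟩
    3 * (m * m)           ≤⟨ 3m²≤ ⟩
    22 + 11 * m           ∎) ⟩
  22           ≤⟨ m≤m+n 22 19 ⟩
  41           ∎)))
  where
  open +-*-Solver
  q = m * m
  t = tri m
  split : ∀ q → 8 * q + 3 * q ≡ 11 * q
  split = solve 1 (λ q → con 8 :* q :+ con 3 :* q := con 11 :* q) refl
  merge : ∀ q m → (11 + 4 * q) + (11 + 4 * q) + 11 * m ≡ 8 * q + (22 + 11 * m)
  merge = solve 2 (λ q m → (con 11 :+ con 4 :* q) :+ (con 11 :+ con 4 :* q) :+ con 11 :* m
                          := con 8 :* q :+ (con 22 :+ con 11 :* m)) refl
  3m²≤ : 3 * q ≤ 22 + 11 * m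
  3m²≤ = +-cancelˡ-≤ (8 * q) (3 * q) (22 + 11 * m) (begin
    8 * q + 3 * q                                   ≡⟨ split q ⟩
    11 * q                                          ≡⟨ cong (11 *_) (2tri m) ⟨
    11 * (t + t + m)                                ≡⟨ *-distribˡ-+ 11 (t + t) m ⟩
    11 * (t + t) + 11 * m                           ≡⟨ cong (_+ 11 * m) (*-distribˡ-+ 11 t t) ⟩
    11 * t + 11 * t + 11 * m                        ≤⟨ +-monoˡ-≤ (11 * m) (+-mono-≤ le le) ⟩
    (11 + 4 * q) + (11 + 4 * q) + 11 * m            ≡⟨ merge q m ⟩
    8 * q + (22 + 11 * m)                           ∎)

-- By `binom-^11` the left side is at most 2^(4m/11), while `ramsey-lower` gives `M` the rate
-- 2^(m/2), and 4/11 < 1/2. Eleventh powers keep the exponents integral.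
ramsey-large : ∀ {m s M} → 6 ≤ m → 45 * s ≤ m → Ramsey (K m) M → binom m s * binom m s < M
ramsey-large {m} {s} {M} 6≤m 45s≤m ramsey = ≰⇒> λ M≤X² → tri-large m 6≤m (2^-cancel-≤ (begin
  2 ^ (11 * t)                      ≡⟨ cong (2 ^_) (*-comm 11 t) ⟩
  2 ^ (t * 11)                      ≡⟨ ^-*-assoc 2 t 11 ⟨
  (2 ^ t) ^ 11                      ≤⟨ ^-monoˡ-≤ 11 (ramsey-lower ramsey) ⟩
  (2 * M ^ m) ^ 11                  ≡⟨ ^-distribʳ-* 11 2 (M ^ m) ⟩
  2 ^ 11 * (M ^ m) ^ 11             ≡⟨ cong (2 ^ 11 *_) (^-comm M m 11) ⟩
  2 ^ 11 * (M ^ 11) ^ m             ≤⟨ *-monoʳ-≤ (2 ^ 11) (^-monoˡ-≤ m (begin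
    M ^ 11                            ≤⟨ ^-monoˡ-≤ 11 M≤X² ⟩
    (X * X) ^ 11                      ≡⟨ ^-distribʳ-* 11 X X ⟩
    X ^ 11 * X ^ 11                   ≤⟨ *-mono-≤ (binom-^11 m s 45s≤m) (binom-^11 m s 45s≤m) ⟩
    2 ^ (m + m) * 2 ^ (m + m)         ≡⟨ ^-distribˡ-+-* 2 (m + m) (m + m) ⟨
    2 ^ (m + m + (m + m))             ≡⟨ cong (2 ^_) (4m m) ⟩
    2 ^ (4 * m)                       ∎)) ⟩
  2 ^ 11 * (2 ^ (4 * m)) ^ m        ≡⟨ cong (2 ^ 11 *_) (trans (^-*-assoc 2 (4 * m) m) (cong (2 ^_) (*-assoc 4 m m))) ⟩
  2 ^ 11 * 2 ^ (4 * (m * m))        ≡⟨ ^-distribˡ-+-* 2 11 (4 * (m * m)) ⟨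
  2 ^ (11 + 4 * (m * m))            ∎))
  where
  X = binom m s
  t = tri m
  4m : ∀ m → m + m + (m + m) ≡ 4 * m
  4m m = trans (+-assoc m m (m + m)) (cong (λ z → m + (m + (m + z))) (sym (+-identityʳ m)))
  2^-cancel-≤ : ∀ {x y} → 2 ^ x ≤ 2 ^ y → x ≤ y
  2^-cancel-≤ {x} {y} le with x ≤? y
  ... | yes x≤y = x≤y
  ... | no  x≰y = contradiction le (<⇒≱ (^-monoʳ-< 2 (s≤s (s≤s z≤n)) (≰⇒> x≰y)))

-- Decidability of the Ramsey property and existence of least witnesses.

IsCopy : ∀ {n N} → Graph n → EdgeColouring N → Bool → (Fin n → Fin N) → Set
IsCopy G κ b φ = Injective _≡_ _≡_ φ × (∀ u v → Adj G u v → colour κ (φ u) (φ v) ≡ b)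

isCopy? : ∀ {n N} (G : Graph n) (κ : EdgeColouring N) b φ → Dec (IsCopy G κ b φ)
isCopy? G κ b φ =
  map′ (λ h {i} {j} → h i j) (λ h i j → h {i} {j})
    (Fin.all? λ i → Fin.all? λ j → (φ i Fin.≟ φ j) →-dec (i Fin.≟ j))
  ×-dec (Fin.all? λ u → Fin.all? λ v → Graph.adj? G u v →-dec (colour κ (φ u) (φ v) Bool.≟ b))

-- Maps are searched through their codes in `Fin (N ^ n)`. A decoded map agrees with the original
-- only pointwise, hence the transport in `encode`.
copy? : ∀ {n N} (G : Graph n) (κ : EdgeColouring N) → Dec (MonochromaticCopy G κ)
copy? {n} {N} G κ = map′ [ (true ,_) , (false ,_) ]′ (λ { (true , c) → inj₁ c ; (false , c) → inj₂ c })
                      (inColour true ⊎-dec inColour false)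
  where
  inColour : ∀ b → Dec (Σ[ φ ∈ (Fin n → Fin N) ] IsCopy G κ b φ)
  inColour b = map′ (λ { (c , copy) → finToFun c , copy }) encode (Fin.any? {n = N ^ n} (isCopy? G κ b ∘ finToFun))
    where
    encode : Σ[ φ ∈ (Fin n → Fin N) ] IsCopy G κ b φ → ∃[ c ] IsCopy G κ b (finToFun {N} {n} c)
    encode (φ , inj , same) = funToFin φ ,
      (λ {i} {j} eq → inj (trans (sym (φ≗ i)) (trans eq (φ≗ j)))) ,
      λ u v adj → trans (cong₂ (colour κ) (φ≗ u) (φ≗ v)) (same u v adj)
      where φ≗ = Fin.finToFun-funToFin φ

copy-resp : ∀ {n N} {G : Graph n} {κ κ′ : EdgeColouring N} → (∀ i j → colour κ i j ≡ colour κ′ i j) →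
            MonochromaticCopy G κ → MonochromaticCopy G κ′
copy-resp eq (b , φ , inj , same) = b , φ , inj , λ u v adj → trans (sym (eq (φ u) (φ v))) (same u v adj)

module ColouringCode (N : ℕ) where

  bit : Fin 2 → Bool
  bit zero    = false
  bit (suc _) = true

  unbit : Bool → Fin 2
  unbit false = zero
  unbit true  = suc zero

  bit-unbit : ∀ b → bit (unbit b) ≡ b
  bit-unbit false = refl
  bit-unbit true  = refl

  -- Taking the conjunction of the two entries makes every code a symmetric colouring.
  decode : Fin (2 ^ (N * N)) → EdgeColouring N
  decode c = record
    { colour     = λ i j → entry i j ∧ entry j i
    ; colour-sym = λ i j → Bool.∧-comm (entry i j) (entry j i)
    }
    where
    entry : Fin N → Fin N → Bool
    entry i j = bit (finToFun c (combine i j))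

  encode : EdgeColouring N → Fin (2 ^ (N * N))
  encode κ = funToFin λ x → unbit (colour κ (quotient N x) (remainder {N} N x))

  decode-encode : ∀ κ i j → colour (decode (encode κ)) i j ≡ colour κ i j
  decode-encode κ i j = trans (cong₂ _∧_ (entry i j) (trans (entry j i) (EdgeColouring.colour-sym κ j i))) (Bool.∧-idem _)
    where
    entry : ∀ i j → bit (finToFun (encode κ) (combine i j)) ≡ colour κ i j
    entry i j = trans (cong bit (Fin.finToFun-funToFin _ (combine i j)))
      (trans (bit-unbit _) (cong (λ { (q , r) → colour κ q r }) (Fin.remQuot-combine {N} i j)))

ramsey? : ∀ {n} (G : Graph n) N → Dec (Ramsey G N)
ramsey? G N = map′
  (λ h κ → copy-resp {G = G} {κ = decode (encode κ)} {κ} (decode-encode κ) (h (encode κ)))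
  (λ h c → h (decode c))
  (Fin.all? (copy? G ∘ decode))
  where open ColouringCode N

least : {P : ℕ → Set} → (∀ n → Dec (P n)) → ∀ {n} → P n → ∃[ r ] IsLeast P r
least {P} P? {n} pn with below (suc n)
  where
  below : ∀ n → (∃[ r ] IsLeast P r) ⊎ (∀ m → m < n → ¬ P m)
  below zero = inj₂ λ _ ()
  below (suc n) with below n | P? n
  ... | inj₁ r | _      = inj₁ r
  ... | inj₂ h | yes pn = inj₁ (n , pn , λ m pm → ≮⇒≥ λ m<n → h m m<n pm)
  ... | inj₂ h | no ¬pn = inj₂ λ m m<1+n pm → [ (λ m<n → h m m<n pm) , (λ { refl → ¬pn pm }) ]′ (m≤n⇒m<n∨m≡n (s≤s⁻¹ m<1+n))
... | inj₁ r = r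
... | inj₂ h = contradiction pn (h n ≤-refl)

ramsey-binom : ∀ {p q N} → p ≤ suc q → binom q q ≤ N → Ramsey (K p) N
ramsey-binom {q = q} {N} p≤ large κ =
  clique⇒copy (clique-≤ p≤ (proj₂ mono-clique))
  where
  open Cliques κ
  mono-clique : ∃[ b ] HasClique b (suc q) (allFin N)
  mono-clique = [ (true ,_) , (false ,_) ]′
    (erdős-szekeres true q q (allFin⁺ N) (≤-trans large (≤-reflexive (sym (length-tabulate id)))))

-- `46` is `suc e` in `ratio-core` for `e = 45`, taken twice for the two colours at a vertex. For
-- `m ≤ 5`, out of reach of `ramsey-large`, the clique has at most six vertices and
-- `binom 5 5 = 252` suffices.
ramsey-ratio : ∀ {m M N} → Ramsey (K m) M → 46 * M + 46 * M ≤ N → binom 5 5 ≤ N → Ramsey (K (suc m)) N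
ramsey-ratio {m} {M} {N} ramsey large large′ with m ≤? 5
... | yes m≤5 = ramsey-binom (s≤s m≤5) large′
... | no  m≰5 = λ κ → decidable-stable (copy? (K (suc m)) κ) λ noCopy →
  let open Cliques κ ; open Extension κ in
  ratio-core {45} {m} {M} {m / 45} ramsey
    (≤-trans (s≤s (≤-reflexive (m≡m%n+[m/n]*n m 45))) (≤-trans (+-monoˡ-< (m / 45 * 45) (m%n<n m 45))
      (≤-reflexive (*-comm (suc (m / 45)) 45))))
    (ramsey-large (≰⇒> m≰5) (≤-trans (≤-reflexive (*-comm 45 (m / 45))) (m/n*n≤m m 45)) ramsey)
    (allFin⁺ N) (≤-trans large (≤-reflexive (sym (length-tabulate id)))) λ b → noCopy ∘ clique⇒copy

-- Cliques with pendant vertices: connectedness, chromatic number, lower bound.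

-- K p on the vertices 0, …, p - 1, and all other vertices pendant at 0.
cliqueStar : ∀ p n → Graph n
cliqueStar p n = record
  { Adj    = λ i j → i ≢ j × ((toℕ i < p × toℕ j < p) ⊎ toℕ i ≡ 0 ⊎ toℕ j ≡ 0)
  ; sym    = λ { (i≢j , inj₁ (i<p , j<p)) → i≢j ∘ sym , inj₁ (j<p , i<p)
               ; (i≢j , inj₂ (inj₁ i≡0))  → i≢j ∘ sym , inj₂ (inj₂ i≡0)
               ; (i≢j , inj₂ (inj₂ j≡0))  → i≢j ∘ sym , inj₂ (inj₁ j≡0) }
  ; irrefl = λ i≡j (i≢j , _) → i≢j i≡j
  ; adj?   = λ i j → ¬? (i Fin.≟ j) ×-dec ((toℕ i <? p ×-dec toℕ j <? p) ⊎-dec (toℕ i ≟ 0 ⊎-dec toℕ j ≟ 0))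
  }

cliqueStar-connected : ∀ p n → 1 ≤ n → Connected (cliqueStar p n)
cliqueStar-connected p (suc n) _ = _ , λ u v → to-zero u ◅◅ from-zero v
  where
  to-zero : ∀ u → Star (Adj (cliqueStar p (suc n))) u zero
  to-zero zero    = ε
  to-zero (suc u) = ((λ ()) , inj₂ (inj₂ refl)) ◅ ε
  from-zero : ∀ v → Star (Adj (cliqueStar p (suc n))) zero v
  from-zero zero    = ε
  from-zero (suc v) = ((λ ()) , inj₂ (inj₁ refl)) ◅ ε

cliqueStar-clique : ∀ {p n} (p≤n : p ≤ n) {i j} → i ≢ j → Adj (cliqueStar p n) (inject≤ i p≤n) (inject≤ j p≤n)
cliqueStar-clique p≤n {i} {j} i≢j = i≢j ∘ Fin.inject≤-injective p≤n p≤n i j , inj₁ (below i , below j)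
  where
  below : ∀ i → toℕ (inject≤ i p≤n) < _
  below i = ≤-trans (s≤s (≤-reflexive (Fin.toℕ-inject≤ i p≤n))) (Fin.toℕ<n i)

cliqueStar⇒K : ∀ {p n X} → p ≤ n → Ramsey (cliqueStar p n) X → Ramsey (K p) X
cliqueStar⇒K p≤n ramsey κ with b , φ , inj , same ← ramsey κ =
  b , (λ i → φ (inject≤ i p≤n)) , (λ eq → Fin.inject≤-injective p≤n p≤n _ _ (inj eq)) ,
  λ u v u≢v → same _ _ (cliqueStar-clique p≤n u≢v)

cliqueStar-χ : ∀ {p n} → 2 ≤ p → p ≤ n → IsChromaticNumber (cliqueStar p n) p
cliqueStar-χ {p} {n} 2≤p p≤n = (f , proper) , λ m (g , g-proper) →
  Fin.injective⇒≤ {f = λ i → g (inject≤ i p≤n)} λ {i} {j} eq → decidable-stable (i Fin.≟ j) λ i≢j →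
    g-proper _ _ (cliqueStar-clique p≤n i≢j) eq
  where
  f : Fin n → Fin p
  f u with toℕ u <? p
  ... | yes u<p = fromℕ< u<p
  -- Pendant vertices get colour 1, so that vertex 0, their only neighbour, is alone in colour 0.
  ... | no  _   = fromℕ< 2≤p
  f-zero : ∀ u → toℕ u ≡ 0 → toℕ (f u) ≡ 0
  f-zero u u≡0 with toℕ u <? p
  ... | yes u<p = trans (Fin.toℕ-fromℕ< u<p) u≡0
  ... | no  u≮p = contradiction (≤-trans (s≤s (≤-reflexive u≡0)) (≤-trans (s≤s z≤n) 2≤p)) u≮p
  f-zero⁻ : ∀ u → toℕ (f u) ≡ 0 → toℕ u ≡ 0
  f-zero⁻ u fu≡0 with toℕ u <? p
  ... | yes u<p = trans (sym (Fin.toℕ-fromℕ< u<p)) fu≡0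
  ... | no  _   = contradiction (trans (sym (Fin.toℕ-fromℕ< 2≤p)) fu≡0) λ ()
  f-below : ∀ u → toℕ u < p → toℕ (f u) ≡ toℕ u
  f-below u u<p with toℕ u <? p
  ... | yes u<p′ = Fin.toℕ-fromℕ< u<p′
  ... | no  u≮p = contradiction u<p u≮p
  proper : ∀ u v → Adj (cliqueStar p n) u v → f u ≢ f v
  proper u v (u≢v , inj₁ (u<p , v<p)) eq =
    u≢v (Fin.toℕ-injective (trans (sym (f-below u u<p)) (trans (cong toℕ eq) (f-below v v<p))))
  proper u v (u≢v , inj₂ (inj₁ u≡0)) eq =
    u≢v (Fin.toℕ-injective (trans u≡0 (sym (f-zero⁻ v (trans (cong toℕ (sym eq)) (f-zero u u≡0))))))
  proper u v (u≢v , inj₂ (inj₂ v≡0)) eq =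
    u≢v (Fin.toℕ-injective (trans (f-zero⁻ u (trans (cong toℕ eq) (f-zero v v≡0))) (sym v≡0)))

-- The colouring by p red blocks of n vertices with blue edges between them.
cliqueStar-lower : ∀ {p n X} → p ≤ n → Ramsey (cliqueStar (suc p) (suc n)) X → p * n < X
cliqueStar-lower {p} {n} {X} p≤n ramsey = ≰⇒> λ X≤pn →
  let
    ι : Fin X → Fin (p * n)
    ι i = inject≤ i X≤pn
    block : Fin X → Fin p
    block i = quotient n (ι i)
    inBlock : Fin X → Fin n
    inBlock i = remainder {p} n (ι i)
    block-injective : ∀ {i j} → block i ≡ block j → inBlock i ≡ inBlock j → i ≡ j
    block-injective {i} {j} eq eq′ = Fin.inject≤-injective X≤pn X≤pn i j
      (trans (sym (Fin.combine-remQuot {p} n (ι i))) (trans (cong₂ combine eq eq′) (Fin.combine-remQuot {p} n (ι j))))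
    κ : EdgeColouring X
    κ = record { colour = λ i j → does (block i Fin.≟ block j) ; colour-sym = λ i j → does-sym (block i) (block j) }
  in case ramsey κ of λ
    -- All vertices of a red copy lie in the block of its centre, which has only `n` of the `n + 1`
    -- places. A blue copy puts its `p + 1` clique vertices into distinct blocks.
    { (true , φ , inj , same) → 1+n≰n (Fin.injective⇒≤ {f = inBlock ∘ φ} λ {u} {v} eq →
        inj (block-injective (trans (to-centre φ block same u) (sym (to-centre φ block same v))) eq))
    ; (false , φ , inj , same) → 1+n≰n (Fin.injective⇒≤ {f = λ i → block (φ (inject≤ i (s≤s p≤n)))} λ {i} {j} eq →
        decidable-stable (i Fin.≟ j) λ i≢j → does-false (same _ _ (cliqueStar-clique (s≤s p≤n) i≢j)) eq) }
  where
  does-sym : ∀ {m} (i j : Fin m) → does (i Fin.≟ j) ≡ does (j Fin.≟ i)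
  does-sym i j with i Fin.≟ j | j Fin.≟ i
  ... | yes _   | yes _   = refl
  ... | yes i≡j | no  j≢i = contradiction (sym i≡j) j≢i
  ... | no  i≢j | yes j≡i = contradiction (sym j≡i) i≢j
  ... | no  _   | no  _   = refl
  does-true : ∀ {m} {i j : Fin m} → does (i Fin.≟ j) ≡ true → i ≡ j
  does-true {i = i} {j} eq with i Fin.≟ j
  ... | yes i≡j = i≡j
  does-false : ∀ {m} {i j : Fin m} → does (i Fin.≟ j) ≡ false → i ≢ j
  does-false {i = i} {j} eq with i Fin.≟ j
  ... | no i≢j = i≢j
  to-centre : ∀ (φ : Fin (suc n) → Fin X) (block : Fin X → Fin p) →
    (∀ u v → Adj (cliqueStar (suc p) (suc n)) u v → does (block (φ u) Fin.≟ block (φ v)) ≡ true) →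
    ∀ u → block (φ u) ≡ block (φ zero)
  to-centre φ block same zero    = refl
  to-centre φ block same (suc u) = does-true (same (suc u) zero ((λ ()) , inj₂ (inj₂ refl)))

-- The upper bound for cliques with pendant vertices.

All-lookup-++ : ∀ {A : Set} {P : Pred A 0ℓ} {xs} ys → All P xs → ∀ i → toℕ i < length xs → P (lookup (xs ++ ys) i)
All-lookup-++ ys (p ∷ _)  zero    _         = p
All-lookup-++ ys (_ ∷ ps) (suc i) (s≤s i<n) = All-lookup-++ ys ps i i<n

AllPairs-lookup-++ : ∀ {A : Set} {R : A → A → Set} → (∀ {x y} → R x y → R y x) → ∀ {xs} ys → AllPairs R xs →
  ∀ i j → toℕ i < length xs → toℕ j < length xs → i ≢ j → R (lookup (xs ++ ys) i) (lookup (xs ++ ys) j)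
AllPairs-lookup-++ R-sym ys (_ ∷ _)  zero    zero    _         _         i≢j = contradiction refl i≢j
AllPairs-lookup-++ R-sym ys (r ∷ _)  zero    (suc j) _         (s≤s j<n) _   = All-lookup-++ ys r j j<n
AllPairs-lookup-++ R-sym ys (r ∷ _)  (suc i) zero    (s≤s i<n) _         _   = R-sym (All-lookup-++ ys r i i<n)
AllPairs-lookup-++ R-sym ys (_ ∷ rs) (suc i) (suc j) (s≤s i<n) (s≤s j<n) i≢j =
  AllPairs-lookup-++ R-sym ys rs i j i<n j<n (i≢j ∘ cong suc)

module Pendants {N : ℕ} (κ : EdgeColouring N) where

  open Cliques κ

  V : List (Fin N)
  V = allFin N

  length-V : length V ≡ N
  length-V = length-tabulate id

  -- The neighbours of `v` outside the clique serve as pendants. The list of `v`, then `xs`, then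
  -- these neighbours follows the numbering of `cliqueStar`, so lookup in it is the embedding.
  copy-at : ∀ {n} b v xs → AllPairs (Edge b) (v ∷ xs) → n ≤ length (nbrs b v V) →
            MonochromaticCopy (cliqueStar (suc (length xs)) n) κ
  copy-at {zero}  b v xs _ _ = b , (λ ()) , (λ { {()} }) , λ ()
  copy-at {suc n} b v xs pairs@(v~xs ∷ xs~xs) deg = b , φ , inj , same
    where
    others : List (Fin N)
    others = filter (¬? ∘ (_∈? xs)) (nbrs b v V)
    others-spec : ∀ {x} → x ∈ others → x ∈ nbrs b v V × x ∉ xs
    others-spec = ∈-filter⁻ (¬? ∘ (_∈? xs)) {xs = nbrs b v V}
    v~rest : All (Edge b v) (xs ++ others)
    v~rest = All.++⁺ v~xs (All.tabulate (proj₂ ∘ ∈-filter⁻ (edge? b v) {xs = V} ∘ proj₁ ∘ others-spec))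
    unique : Unique (v ∷ xs ++ others)
    unique = All.map proj₁ v~rest ∷
      ++⁺ (AllPairs.map proj₁ xs~xs) (filter⁺ (¬? ∘ (_∈? xs)) (nbrs-unique b v (allFin⁺ N)))
        λ (x∈xs , x∈others) → proj₂ (others-spec x∈others) x∈xs
    large : suc n ≤ length (v ∷ xs ++ others)
    large = begin
      suc n                                ≤⟨ deg ⟩
      length (nbrs b v V)                  ≤⟨ length-without Fin._≟_ (nbrs-unique b v (allFin⁺ N)) xs ⟩
      length xs + length others            ≡⟨ length-++ xs ⟨
      length (xs ++ others)                ≤⟨ n≤1+n _ ⟩
      length (v ∷ xs ++ others)            ∎
    φ : Fin (suc n) → Fin N
    φ i = lookup (v ∷ xs ++ others) (inject≤ i large)
    inj : Injective _≡_ _≡_ φ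
    inj eq = Fin.inject≤-injective large large _ _ (Unique-lookup-injective unique eq)
    to-centre : ∀ w → Edge b v (φ (suc w))
    to-centre w = All.lookup v~rest (∈-lookup _)
    below : ∀ {p} w → toℕ w < p → toℕ (inject≤ w large) < p
    below w = subst (_< _) (sym (Fin.toℕ-inject≤ w large))
    same : ∀ u w → Adj (cliqueStar (suc (length xs)) (suc n)) u w → colour κ (φ u) (φ w) ≡ b
    same u w (u≢w , inj₁ (u<p , w<p)) =
      proj₂ (AllPairs-lookup-++ edge-sym others pairs (inject≤ u large) (inject≤ w large) (below u u<p) (below w w<p)
        (u≢w ∘ Fin.inject≤-injective large large u w))
    same zero    zero    (u≢w , inj₂ _)         = contradiction refl u≢w
    same zero    (suc w) (_ , inj₂ _)           = proj₂ (to-centre w)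
    same (suc u) zero    (_ , inj₂ _)           = proj₂ (edge-sym (to-centre u))
    same (suc u) (suc w) (_ , inj₂ (inj₁ ()))
    same (suc u) (suc w) (_ , inj₂ (inj₂ ()))

  copy-at-clique : ∀ {b p n U} → 1 ≤ p → HasClique b p U → (∀ {v} → v ∈ U → n ≤ length (nbrs b v V)) →
                   MonochromaticCopy (cliqueStar p n) κ
  copy-at-clique _ (v ∷ xs , refl , pairs , ⊆U) deg = copy-at _ v xs pairs (deg (⊆U (here refl)))
  copy-at-clique () ([] , refl , _) _

  nonEdges-few : ∀ b u {U} → Unique U → count (nonEdge? b u) U ≤ suc (length (nbrs (not b) u V))
  nonEdges-few b u {U} uU =
    unique-⊆⇒≤ Fin._≟_ (filter⁺ (nonEdge? b u) uU) (u ∷ nbrs (not b) u V) λ {w} w∈ → classify (proj₂ (∈-filter⁻ (nonEdge? b u) {xs = U} w∈))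
    where
    classify : ∀ {w} → ¬ Edge b u w → w ∈ u ∷ nbrs (not b) u V
    classify {w} ¬e with u Fin.≟ w
    ... | yes u≡w = here (sym u≡w)
    ... | no  u≢w = there (∈-filter⁺ (edge? (not b) u) (∈-allFin w) ([ (λ e → contradiction e ¬e) , id ]′ (edge-total b u≢w)))

  -- Each choice uses up at most `n` vertices: the chosen one and its fewer than `n` neighbours of
  -- the other colour.
  greedy : ∀ b p {n U} → 1 ≤ n → Unique U → p * n ≤ length U → (∀ {u} → u ∈ U → length (nbrs (not b) u V) < n) →
           HasClique b p U
  greedy b zero    _ _ _ _ = [] , refl , [] , λ ()
  greedy b (suc p) {suc n} {[]}    _ _ () _
  greedy b (suc p) {suc n} {v ∷ U} 1≤n u large deg =
    clique-∷ (here refl) nbrs⊆ (all-filter (edge? b v) (v ∷ U))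
      (greedy b p 1≤n (nbrs-unique b v u) large′ (deg ∘ nbrs⊆))
    where
    nbrs⊆ = nbrs-⊆ b v (v ∷ U)
    large′ : p * suc n ≤ length (nbrs b v (v ∷ U))
    large′ = +-cancelˡ-≤ (suc n) _ _ (begin
      suc n + p * suc n                                              ≤⟨ large ⟩
      length (v ∷ U)                                                 ≤⟨ count-cover¬ (edge? b v) (v ∷ U) ⟩
      length (nbrs b v (v ∷ U)) + count (nonEdge? b v) (v ∷ U)       ≤⟨ +-monoʳ-≤ (length (nbrs b v (v ∷ U))) (≤-trans (nonEdges-few b v u) (deg (here refl))) ⟩
      length (nbrs b v (v ∷ U)) + suc n                              ≡⟨ +-comm (length (nbrs b v (v ∷ U))) (suc n) ⟩
      suc n + length (nbrs b v (v ∷ U))                              ∎)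

  low? : ∀ b n → Decidable (λ v → length (nbrs b v V) < n)
  low? b n v = length (nbrs b v V) <? n

  -- A vertex with fewer than `n` neighbours of colour `not b` has at least `N - n ≥ n` of colour
  -- `b`, so every vertex of the greedy clique can carry the pendants.
  low-copy : ∀ b {p n U} → 1 ≤ p → 1 ≤ n → n + n ≤ N → Unique U → p * n ≤ count (low? (not b) n) U →
             MonochromaticCopy (cliqueStar p n) κ
  low-copy b {p} {n} {U} 1≤p 1≤n 2n≤N u large =
    copy-at-clique 1≤p (greedy b p 1≤n (filter⁺ (low? (not b) n) u) large low) λ {v} v∈ →
      +-cancelʳ-≤ n n _ (begin
        n + n                                                 ≤⟨ 2n≤N ⟩
        N                                                     ≡⟨ length-V ⟨
        length V                                              ≤⟨ count-cover¬ (edge? b v) V ⟩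
        length (nbrs b v V) + count (nonEdge? b v) V          ≤⟨ +-monoʳ-≤ (length (nbrs b v V)) (≤-trans (nonEdges-few b v (allFin⁺ N)) (low v∈)) ⟩
        length (nbrs b v V) + n                               ∎)
    where
    low : ∀ {v} → v ∈ filter (low? (not b) n) U → length (nbrs (not b) v V) < n
    low = proj₂ ∘ ∈-filter⁻ (low? (not b) n) {xs = U}

  2n≤N : ∀ {p n Q} → 1 ≤ p → Q + p * n + p * n ≤ N → n + n ≤ N
  2n≤N {p} {n} {Q} 1≤p large = ≤-trans (+-mono-≤ (≤-trans n≤pn (m≤n+m _ Q)) n≤pn) large
    where n≤pn = ≤-trans (≤-reflexive (sym (*-identityˡ n))) (*-monoˡ-≤ n 1≤p)

  -- If neither colour has p n vertices of small degree, then Q vertices have degree at least n in both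
  -- colours, so that any monochromatic K p among them extends.
  copy : ∀ {p n Q} → 1 ≤ p → 1 ≤ n → Ramsey (K p) Q → Q + p * n + p * n ≤ N → MonochromaticCopy (cliqueStar p n) κ
  copy {p} {n} {Q} 1≤p 1≤n ramsey large with p * n ≤? count (low? true n) V
  ... | yes many = low-copy false 1≤p 1≤n (2n≤N 1≤p large) (allFin⁺ N) many
  ... | no few with p * n ≤? count (low? false n) (filter (¬? ∘ low? true n) V)
  ...   | yes many = low-copy true 1≤p 1≤n (2n≤N 1≤p large) (filter⁺ (¬? ∘ low? true n) (allFin⁺ N)) many
  ...   | no few′ = copy-at-clique 1≤p (proj₂ mono-clique) (high (proj₁ mono-clique))
    where
    H₁ = filter (¬? ∘ low? true n) V
    H₂ = filter (¬? ∘ low? false n) H₁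
    H₂-large : Q ≤ length H₂
    H₂-large = +-cancelʳ-≤ (p * n + p * n) Q _ (begin
      Q + (p * n + p * n)                                                ≡⟨ +-assoc Q (p * n) (p * n) ⟨
      Q + p * n + p * n                                                  ≤⟨ large ⟩
      N                                                                  ≡⟨ length-V ⟨
      length V                                                           ≤⟨ count-cover¬ (low? true n) V ⟩
      count (low? true n) V + length H₁                                  ≤⟨ +-mono-≤ (≰⇒≥ few) (count-cover¬ (low? false n) H₁) ⟩
      p * n + (count (low? false n) H₁ + length H₂)                      ≤⟨ +-monoʳ-≤ (p * n) (+-monoˡ-≤ (length H₂) (≰⇒≥ few′)) ⟩
      p * n + (p * n + length H₂)                                        ≡⟨ +-assoc (p * n) (p * n) _ ⟨
      p * n + p * n + length H₂                                          ≡⟨ +-comm (p * n + p * n) _ ⟩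
      length H₂ + (p * n + p * n)                                        ∎)
    mono-clique = ramsey⇒clique ramsey (filter⁺ (¬? ∘ low? false n) (filter⁺ (¬? ∘ low? true n) (allFin⁺ N))) H₂-large
    high : ∀ b {v} → v ∈ H₂ → n ≤ length (nbrs b v V)
    high true  v∈ = ≮⇒≥ (proj₂ (∈-filter⁻ (¬? ∘ low? true n) {xs = V} (proj₁ (∈-filter⁻ (¬? ∘ low? false n) {xs = H₁} v∈))))
    high false v∈ = ≮⇒≥ (proj₂ (∈-filter⁻ (¬? ∘ low? false n) {xs = H₁} v∈))

cliqueStar-upper : ∀ {p n Q} → 1 ≤ p → 1 ≤ n → Ramsey (K p) Q → Ramsey (cliqueStar p n) (Q + p * n + p * n)
cliqueStar-upper 1≤p 1≤n ramsey κ = Pendants.copy κ 1≤p 1≤n ramsey ≤-refl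

-- Interpolation between linear growth and the Ramsey number of the complete graph.

ramseyNumber : ∀ {p n} → 1 ≤ p → 1 ≤ n → ∃[ r ] IsRamseyNumber (cliqueStar p n) r
ramseyNumber {p} {n} 1≤p 1≤n =
  least (ramsey? (cliqueStar p n)) (cliqueStar-upper 1≤p 1≤n (ramsey-binom {q = p} (n≤1+n p) ≤-refl))

cliqueStar-base : ∀ {k p n r} → 1 ≤ p → p ≤ k → 1 ≤ n → IsRamseyNumber (cliqueStar p n) r → r ≤ (binom k k + k + k) * n
cliqueStar-base {k} {p} {n} {r} 1≤p p≤k 1≤n (_ , minimal) = begin
  r                                          ≤⟨ minimal _ (cliqueStar-upper 1≤p 1≤n (ramsey-binom {q = k} (m≤n⇒m≤1+n p≤k) ≤-refl)) ⟩
  binom k k + p * n + p * n                  ≤⟨ +-mono-≤ (+-mono-≤ binom≤ (*-monoˡ-≤ n p≤k)) (*-monoˡ-≤ n p≤k) ⟩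
  binom k k * n + k * n + k * n              ≡⟨ cong (_+ k * n) (*-distribʳ-+ n (binom k k) k) ⟨
  (binom k k + k) * n + k * n                ≡⟨ *-distribʳ-+ n (binom k k + k) k ⟨
  (binom k k + k + k) * n                    ∎
  where
  binom≤ : binom k k ≤ binom k k * n
  binom≤ = ≤-trans (≤-reflexive (sym (*-identityʳ _))) (*-monoʳ-≤ (binom k k) 1≤n)

-- 264 = 252 + 2 · 6: R (K (m + 1)) ≤ 252 r, and (m + 1) n ≤ 6 (m - 1) (n - 1) < 6 r.
cliqueStar-step : ∀ {m n r r′} → 2 ≤ m → m < n → IsRamseyNumber (cliqueStar m n) r → IsRamseyNumber (cliqueStar (suc m) n) r′ →
                  r′ ≤ 264 * r
cliqueStar-step {suc p@(suc _)} {suc n@(suc _)} {r} {r′} (s≤s (s≤s _)) m<n@(s≤s p<n) (ramsey , _) (_ , minimal) = begin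
  -- `r` is itself a Ramsey bound for `K m`, which the graph contains, so it stands in for the
  -- Ramsey number of `K m`.
  r′                                            ≤⟨ minimal _ (cliqueStar-upper (s≤s z≤n) (s≤s z≤n) (ramsey-ratio {M = r} (cliqueStar⇒K (<⇒≤ m<n) ramsey) large₁ large₂)) ⟩
  binom 5 5 * r + suc (suc p) * suc n + suc (suc p) * suc n  ≤⟨ +-mono-≤ (+-monoʳ-≤ (binom 5 5 * r) mn≤) mn≤ ⟩
  binom 5 5 * r + 6 * r + 6 * r                 ≡⟨ cong (_+ 6 * r) (*-distribʳ-+ r (binom 5 5) 6) ⟨
  (binom 5 5 + 6) * r + 6 * r                   ≡⟨ *-distribʳ-+ r (binom 5 5 + 6) 6 ⟨
  264 * r                                       ∎
  where
  pn<r : p * n < r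
  pn<r = cliqueStar-lower (<⇒≤ p<n) ramsey
  large₁ : 46 * r + 46 * r ≤ binom 5 5 * r
  large₁ = ≤-trans (≤-reflexive (sym (*-distribʳ-+ r 46 46))) (*-monoˡ-≤ r (≤ᵇ⇒≤ 92 (binom 5 5) tt))
  large₂ : binom 5 5 ≤ binom 5 5 * r
  large₂ = ≤-trans (≤-reflexive (sym (*-identityʳ (binom 5 5)))) (*-monoʳ-≤ (binom 5 5) (≤-trans (s≤s z≤n) pn<r))
  rearrange : ∀ p n → 3 * p * (2 * n) ≡ 6 * (p * n)
  rearrange = solve 2 (λ p n → con 3 :* p :* (con 2 :* n) := con 6 :* (p :* n)) refl
    where open +-*-Solver
  2+p≤3p : ∀ p → 1 ≤ p → suc (suc p) ≤ 3 * p
  2+p≤3p p 1≤p = ≤-trans (≤-reflexive (+-comm 2 p)) (+-monoʳ-≤ p (+-mono-≤ 1≤p (+-mono-≤ 1≤p z≤n)))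
  1+n≤2n : ∀ n → 1 ≤ n → suc n ≤ 2 * n
  1+n≤2n n 1≤n = ≤-trans (≤-reflexive (+-comm 1 n)) (+-monoʳ-≤ n (+-mono-≤ 1≤n z≤n))
  mn≤ : suc (suc p) * suc n ≤ 6 * r
  mn≤ = begin
    suc (suc p) * suc n        ≤⟨ *-mono-≤ (2+p≤3p p (s≤s z≤n)) (1+n≤2n n (s≤s z≤n)) ⟩
    3 * p * (2 * n)            ≡⟨ rearrange p n ⟩
    6 * (p * n)                ≤⟨ *-monoʳ-≤ 6 (<⇒≤ pn<r) ⟩
    6 * r                      ∎

-- The least m with R (cliqueStar m n) at least y overshoots y by a bounded factor only.
interpolate : ∀ {k n y C} → 264 ≤ C → binom k k + k + k ≤ C → 2 ≤ k → 1 ≤ n → n ≤ y → (∀ r → IsRamseyNumber (K n) r → y ≤ r) →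
  ∃[ m ] k ⊓ n ≤ m × m ≤ n × ∃[ r ] IsRamseyNumber (cliqueStar m n) r × y ≤ r × r ≤ C * y
interpolate {k} {n} {y} {C} 264≤C base≤C 2≤k 1≤n n≤y y≤R = go (≤⇒≤′ (m⊓n≤n k n)) ≤-refl (proj₂ top) y≤top
  where
  1≤k⊓n : 1 ≤ k ⊓ n
  1≤k⊓n = ⊓-glb (≤-trans (s≤s z≤n) 2≤k) 1≤n
  top = ramseyNumber {n} {n} 1≤n 1≤n
  clique-number = least (ramsey? (K n)) (ramsey-binom {n} {n} (n≤1+n n) ≤-refl)
  y≤top : y ≤ proj₁ top
  y≤top = ≤-trans (y≤R _ (proj₂ clique-number)) (proj₂ (proj₂ clique-number) _ (cliqueStar⇒K ≤-refl (proj₁ (proj₂ top))))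
  -- Descends from `m = n` with `y ≤ r` as invariant, and stops at `k ⊓ n`, where `r` is linear in
  -- `n ≤ y`, or as soon as the next Ramsey number is below `y`.
  go : ∀ {m r} → k ⊓ n ≤′ m → m ≤ n → IsRamseyNumber (cliqueStar m n) r → y ≤ r →
    ∃[ m ] k ⊓ n ≤ m × m ≤ n × ∃[ r ] IsRamseyNumber (cliqueStar m n) r × y ≤ r × r ≤ C * y
  go {r = r} ≤′-refl m≤n isR y≤r = _ , ≤-refl , m≤n , r , isR , y≤r ,
    ≤-trans (cliqueStar-base 1≤k⊓n (m⊓n≤m k n) 1≤n isR) (*-mono-≤ base≤C n≤y)
  go {r = r} (≤′-step {m} k⊓n≤′m) m<n isR y≤r with ramseyNumber (≤-trans 1≤k⊓n (≤′⇒≤ k⊓n≤′m)) 1≤n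
  ... | r⁻ , isR⁻ with y ≤? r⁻
  ...   | yes y≤r⁻ = go k⊓n≤′m (<⇒≤ m<n) isR⁻ y≤r⁻
  ...   | no  y≰r⁻ = _ , ≤′⇒≤ (≤′-step k⊓n≤′m) , m<n , r , isR , y≤r ,
    ≤-trans (cliqueStar-step 2≤m m<n isR⁻ isR) (*-mono-≤ 264≤C (≰⇒≥ y≰r⁻))
    where
    2≤m : 2 ≤ m
    -- For `n ≤ k` the descent starts at its end, so a step down occurs only above `k ≥ 2`.
    2≤m with ⊓-sel k n
    ... | inj₁ k⊓n≡k = ≤-trans (≤-trans 2≤k (≤-reflexive (sym k⊓n≡k))) (≤′⇒≤ k⊓n≤′m)
    ... | inj₂ k⊓n≡n = contradiction (≤-trans (≤-reflexive (sym k⊓n≡n)) (≤′⇒≤ k⊓n≤′m)) (<⇒≱ m<n)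

-- Passage to rational constants and conclusion.

fromℕ-mono : ∀ {a b} → a ≤ b → fromℕ a ℚ.≤ fromℕ b
fromℕ-mono a≤b = *≤* (ℤ.*-monoʳ-≤-nonNeg (ℤ.+ 1) (+≤+ a≤b))

fromℕ-* : ∀ a b → fromℕ (a * b) ≡ fromℕ a ℚ.* fromℕ b
fromℕ-* a b = ℚ.toℚᵘ-injective (ℚᵘ.≃-trans
  (*≡* (cong (ℤ._* (ℤ.+ 1)) (ℤ.pos-* a b))) (ℚᵘ.≃-sym (ℚ.toℚᵘ-homo-* (fromℕ a) (fromℕ b))))

theorem5p2 : ∀ k → 2 ≤ k →
    Σ[ c ∈ ℚ ] Σ[ C ∈ ℚ ] Σ[ n₀ ∈ ℕ ] 0ℚ ℚ.< c × 0ℚ ℚ.< C ×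
    ((f : ℕ → ℕ) →
    (∀ m n → 1 ≤ m → m ≤ n → f m ≤ f n) →
    (∀ n → 1 ≤ n → n ≤ f n) →
    (∀ n → 1 ≤ n → ∀ r → IsRamseyNumber (K n) r → f n ≤ r) →
    Σ[ G ∈ (∀ n → Graph n) ]
    (∀ n → 1 ≤ n → Connected (G n)) ×
    (∀ n → 1 ≤ n → ∃[ r ] IsRamseyNumber (G n) r × c ℚ.* fromℕ (f n) ℚ.≤ fromℕ r × fromℕ r ℚ.≤ C ℚ.* fromℕ (f n)) ×
    (∀ n → 1 ≤ n → n₀ ≤ n → ∃[ χ ] IsChromaticNumber (G n) χ × k ≤ χ))
theorem5p2 k 2≤k =
  -- `c = 1` because the chosen Ramsey number is never below `f n`; `n₀ = k` because `k ⊓ n = k`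
  -- from there on.
  1ℚ , fromℕ C , k , ℚ.positive⁻¹ 1ℚ , ℚ.positive⁻¹ (fromℕ C) , λ f _ n≤f f≤R →
  let
    m : ℕ → ℕ
    m = λ { zero → 0 ; (suc n) → proj₁ (choice f n≤f f≤R n) }
  in
  (λ n → cliqueStar (m n) n) ,
  (λ n → cliqueStar-connected (m n) n) ,
  (λ { (suc n) _ → let _ , _ , _ , r , isR , f≤r , r≤Cf = choice f n≤f f≤R n in
    r , isR , ℚ.≤-trans (ℚ.≤-reflexive (ℚ.*-identityˡ (fromℕ (f (suc n))))) (fromℕ-mono f≤r) ,
    ℚ.≤-trans (fromℕ-mono r≤Cf) (ℚ.≤-reflexive (fromℕ-* C (f (suc n)))) }) ,
  (λ { (suc n) _ k≤n → let m , k⊓n≤m , m≤n , _ = choice f n≤f f≤R n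
                           k≤m = ≤-trans (≤-reflexive (sym (m≤n⇒m⊓n≡m k≤n))) k⊓n≤m in
    m , cliqueStar-χ (≤-trans 2≤k k≤m) m≤n , k≤m })
  where
  C : ℕ
  -- The sum dominates both the factor of a single step and the factor at the base.
  C = 264 + (binom k k + k + k)
  choice : ∀ f → (∀ n → 1 ≤ n → n ≤ f n) → (∀ n → 1 ≤ n → ∀ r → IsRamseyNumber (K n) r → f n ≤ r) → ∀ n →
    ∃[ m ] k ⊓ suc n ≤ m × m ≤ suc n ×
      ∃[ r ] IsRamseyNumber (cliqueStar m (suc n)) r × f (suc n) ≤ r × r ≤ C * f (suc n)
  choice f n≤f f≤R n = interpolate (m≤m+n 264 _) (m≤n+m (binom k k + k + k) 264) 2≤k (s≤s z≤n) (n≤f (suc n) (s≤s z≤n)) (f≤R (suc n) (s≤s z≤n))
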